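{- Let $\sigma$ be a sequent. (1) If $\sigma$ is valid over the class of epistemic frames, then $\sigma$ has a cyclic proof in $\mathrm{cICK}$. (2) If $\sigma$ is valid over the class of reflexive frames, then $\sigma$ has a cyclic proof in $\mathrm{cICKT}$. (3) If $\sigma$ is valid over the class of S4 frames, then $\sigma$ has a cyclic proof in $\mathrm{cICKS4}$.
   Context: Formulae over a finite non-empty set $\mathsf{A}$ of agents and atoms $\mathrm{Prop}$: $\varphi ::= \bot \mid p \mid \varphi\wedge\varphi\mid\varphi\vee\varphi\mid\varphi\to\varphi\mid K_a\varphi\mid C\varphi$. Semantics: an epistemic frame $(\mathcal{W},\leq,\{R_a\})$ has $\mathcal{W}\neq\emptyset$, $\leq$ a partial order, $R_a\subseteq\mathcal{W}^2$ with triangle confluence ($w\leq v$, $vR_au$ imply $wR_au$); reflexive/S4 frames have each $R_a$ reflexive / reflexive and transitive. Models add a $\leq$-monotone valuation; $w\models\varphi\to\psi$ iff for all $v\geq w$, $v\models\varphi$ implies $v\models\psi$; $w\models K_a\varphi$ iff all $R_a$-successors satisfy $\varphi$; $w\models C\varphi$ iff all $R^*$-successors satisfy $\varphi$ ($R^*$ reflexive–transitive closure of $\bigcup_aR_a$); atoms, $\bot,\wedge,\vee$ as usual. Sequents: annotated formulae $\varphi^x$, $x\in\{\mathsf{u},\mathsf{f}\}$; $\Gamma^-=\{\varphi:\varphi^x\in\Gamma\}$; $K_a\Gamma=\{(K_a\psi)^x:\psi^x\in\Gamma\}$. A sequent $\Gamma\Rightarrow\Delta$ has finite sets of annotated formulae,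 all of $\Gamma$ unfocused, at most one focused formula in $\Delta$, of form $C\psi$ or $K_aC\psi$; valid over a class if $\bigwedge\Gamma^-\to\bigvee\Delta^-$ is. Rules (premises / conclusion; $x\in\{\mathsf{u},\mathsf{f}\}$; premises and conclusion must be sequents): axioms id: $\Gamma,\varphi^{\mathsf{u}}\Rightarrow\varphi^x,\Delta$, $\bot$: $\Gamma,\bot^{\mathsf{u}}\Rightarrow\Delta$; $\wedge$L: $\Gamma,\varphi^{\mathsf{u}},\psi^{\mathsf{u}}\Rightarrow\Delta$ / $\Gamma,(\varphi\wedge\psi)^{\mathsf{u}}\Rightarrow\Delta$; $\wedge$R: $\Gamma\Rightarrow\varphi^{\mathsf{u}},\Delta$, $\Gamma\Rightarrow\psi^{\mathsf{u}},\Delta$ / $\Gamma\Rightarrow(\varphi\wedge\psi)^{\mathsf{u}},\Delta$; $\vee$L: $\Gamma,\varphi^{\mathsf{u}}\Rightarrow\Delta$, $\Gamma,\psi^{\mathsf{u}}\Rightarrow\Delta$ / $\Gamma,(\varphi\vee\psi)^{\mathsf{u}}\Rightarrow\Delta$; $\vee$R: $\Gamma\Rightarrow\varphi^{\mathsf{u}},\psi^{\mathsf{u}},\Delta$ / $\Gamma\Rightarrow(\varphi\vee\psi)^{\mathsf{u}},\Delta$; $\to$L: $\Gamma\Rightarrow\varphi^{\mathsf{u}},\Delta$, $\Gamma,\psi^{\mathsf{u}}\Rightarrow\Delta$ / $\Gamma,(\varphi\to\psi)^{\mathsf{u}}\Rightarrow\Delta$; $\to$R: $\Gamma,\varphi^{\mathsf{u}}\Rightarrow\psi^{\mathsf{u}}$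 / $\Gamma\Rightarrow(\varphi\to\psi)^{\mathsf{u}},\Delta$; u: $\Gamma\Rightarrow\varphi^{\mathsf{u}},\Delta$ / $\Gamma\Rightarrow\varphi^{\mathsf{f}},\Delta$; f: $\Gamma\Rightarrow\varphi^{\mathsf{f}},\Delta$ / $\Gamma\Rightarrow\varphi^{\mathsf{u}},\Delta$; $\mathsf{K}_a$: $\Gamma\Rightarrow\varphi^x$ / $\Pi,K_a\Gamma\Rightarrow(K_a\varphi)^x,\Sigma$; $\mathsf{T}_a$: $\Gamma,\varphi^{\mathsf{u}}\Rightarrow\Delta$ / $\Gamma,(K_a\varphi)^{\mathsf{u}}\Rightarrow\Delta$; $\mathsf{S4}_a$: $K_a\Gamma\Rightarrow\varphi^x$ / $\Pi,K_a\Gamma\Rightarrow(K_a\varphi)^x,\Sigma$; CL: $\Gamma,\varphi^{\mathsf{u}},\{(K_aC\varphi)^{\mathsf{u}}\}_{a}\Rightarrow\Delta$ / $\Gamma,(C\varphi)^{\mathsf{u}}\Rightarrow\Delta$; CR: $\Gamma\Rightarrow\varphi^{\mathsf{u}},\Delta$ and for each $a$, $\Gamma\Rightarrow(K_aC\varphi)^x,\Delta$ / $\Gamma\Rightarrow(C\varphi)^x,\Delta$ ($C\varphi$ principal). $\mathrm{cICK}$: id, $\bot$, $\wedge$L/R, $\vee$L/R, $\to$L/R, u, f, $\mathsf{K}_a$, CL, CR; $\mathrm{cICKT}$ adds $\mathsf{T}_a$; $\mathrm{cICKS4}$ is $\mathrm{cICKT}$ with $\mathsf{K}_a$ replaced by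 $\mathsf{S4}_a$. A cyclic pre-proof of $\sigma$ is a finite tree labelled by sequents, root $\sigma$, each inner node and its children forming a rule instance. A path is successful if every sequent on it has a focused formula and it passes through at least one CR instance with principal formula in focus; a repetition $(u,v)$: distinct nodes, $v$ a descendant of $u$, same label; successful if the path $u$ to $v$ is. A cyclic proof: every leaf is an axiom instance or the upper node $v$ of some successful repetition $(u,v)$. -}

module Defs where

open import Data.Nat using (ℕ; suc)
open import Data.Fin using (Fin)
open import Data.List using (List; []; _∷_; [_]; _++_; map; length; lookup; allFin)
open import Data.List.Membership.Propositional using (_∈_)
open import Data.List.Relation.Binary.Subset.Propositional using (_⊆_)
open import Data.List.Relation.Binary.Pointwise using (Pointwise)
open import Data.Product using (Σ; _×_; _,_; ∃)
open import Data.Sum using (_⊎_)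
open import Data.Empty using (⊥)
open import Data.Unit using (⊤)
open import Relation.Binary.PropositionalEquality using (_≡_; _≢_)
open import Relation.Binary.Construct.Closure.ReflexiveTransitive using (Star)

-- Syntax.  Agents: the finite non-empty set Fin (suc n).  Atoms: ℕ.

data Fm (n : ℕ) : Set where
  ⊥'   : Fm n
  atom : ℕ → Fm n
  _∧_  : Fm n → Fm n → Fm n
  _∨_  : Fm n → Fm n → Fm n
  _⊃_  : Fm n → Fm n → Fm n
  K    : Fin (suc n) → Fm n → Fm n
  C    : Fm n → Fm n

data Ann : Set where
  unf foc : Ann

record AFm (n : ℕ) : Set where
  constructor _^_
  field
    fm  : Fm n
    ann : Ann
open AFm public

-- Sequents: finite sets of annotated formulae, represented by lists
-- and always considered up to set equality (same members).
record Seq (n : ℕ) : Set where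
  constructor _⊢_
  field
    ante : List (AFm n)
    succ : List (AFm n)
open Seq public

_≈L_ : ∀ {A : Set} → List A → List A → Set
xs ≈L ys = (xs ⊆ ys) × (ys ⊆ xs)

_≈S_ : ∀ {n} → Seq n → Seq n → Set
σ ≈S ρ = (ante σ ≈L ante ρ) × (succ σ ≈L succ ρ)

data FocShape {n : ℕ} : Fm n → Set where
  isC  : ∀ ψ → FocShape (C ψ)
  isKC : ∀ a ψ → FocShape (K a (C ψ))

record IsSequent {n : ℕ} (σ : Seq n) : Set where
  field
    anteUnf  : ∀ {χ} → χ ∈ ante σ → ann χ ≡ unf
    focShape : ∀ {χ} → χ ∈ succ σ → ann χ ≡ foc → FocShape (fm χ)
    focOne   : ∀ {χ χ'} → χ ∈ succ σ → χ' ∈ succ σ →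
               ann χ ≡ foc → ann χ' ≡ foc → χ ≡ χ'

HasFocus : ∀ {n} → Seq n → Set
HasFocus σ = ∃ λ χ → (χ ∈ succ σ) × (ann χ ≡ foc)

data Sys : Set where
  ICK ICKT ICKS4 : Sys

data HasK : Sys → Set where
  kICK : HasK ICK
  kICKT : HasK ICKT

data HasT : Sys → Set where
  tICKT : HasT ICKT
  tICKS4 : HasT ICKS4

data HasS4 : Sys → Set where
  s4ICKS4 : HasS4 ICKS4

module _ {n : ℕ} where

  KΓ : Fin (suc n) → List (AFm n) → List (AFm n)
  KΓ a = map (λ χ → K a (fm χ) ^ ann χ)

  KCs : Fm n → List (AFm n)
  KCs φ = map (λ a → K a (C φ) ^ unf) (allFin (suc n))

  -- Inst s ps ρ : premises ps (in order) / conclusion ρ is an instance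
  -- of a rule of system s (Γ, φ written as φ ∷ Γ; sets up to ≈S).
  data Inst (s : Sys) : List (Seq n) → Seq n → Set where
    idAx : ∀ Γ Δ φ x → Inst s [] ((φ ^ unf ∷ Γ) ⊢ (φ ^ x ∷ Δ))
    botL : ∀ Γ Δ → Inst s [] ((⊥' ^ unf ∷ Γ) ⊢ Δ)
    andL : ∀ Γ Δ φ ψ →
      Inst s [ (φ ^ unf ∷ ψ ^ unf ∷ Γ) ⊢ Δ ] (((φ ∧ ψ) ^ unf ∷ Γ) ⊢ Δ)
    andR : ∀ Γ Δ φ ψ →
      Inst s ((Γ ⊢ (φ ^ unf ∷ Δ)) ∷ (Γ ⊢ (ψ ^ unf ∷ Δ)) ∷ [])
             (Γ ⊢ ((φ ∧ ψ) ^ unf ∷ Δ))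
    orL : ∀ Γ Δ φ ψ →
      Inst s (((φ ^ unf ∷ Γ) ⊢ Δ) ∷ ((ψ ^ unf ∷ Γ) ⊢ Δ) ∷ [])
             (((φ ∨ ψ) ^ unf ∷ Γ) ⊢ Δ)
    orR : ∀ Γ Δ φ ψ →
      Inst s [ Γ ⊢ (φ ^ unf ∷ ψ ^ unf ∷ Δ) ] (Γ ⊢ ((φ ∨ ψ) ^ unf ∷ Δ))
    impL : ∀ Γ Δ φ ψ →
      Inst s ((Γ ⊢ (φ ^ unf ∷ Δ)) ∷ ((ψ ^ unf ∷ Γ) ⊢ Δ) ∷ [])
             (((φ ⊃ ψ) ^ unf ∷ Γ) ⊢ Δ)
    impR : ∀ Γ Δ φ ψ →
      Inst s [ (φ ^ unf ∷ Γ) ⊢ [ ψ ^ unf ] ] (Γ ⊢ ((φ ⊃ ψ) ^ unf ∷ Δ))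
    uRule : ∀ Γ Δ φ → Inst s [ Γ ⊢ (φ ^ unf ∷ Δ) ] (Γ ⊢ (φ ^ foc ∷ Δ))
    fRule : ∀ Γ Δ φ → Inst s [ Γ ⊢ (φ ^ foc ∷ Δ) ] (Γ ⊢ (φ ^ unf ∷ Δ))
    kRule : HasK s → ∀ a Γ Π Σ' φ x →
      Inst s [ Γ ⊢ [ φ ^ x ] ] ((Π ++ KΓ a Γ) ⊢ (K a φ ^ x ∷ Σ'))
    tRule : HasT s → ∀ a Γ Δ φ →
      Inst s [ (φ ^ unf ∷ Γ) ⊢ Δ ] ((K a φ ^ unf ∷ Γ) ⊢ Δ)
    s4Rule : HasS4 s → ∀ a Γ Π Σ' φ x →
      Inst s [ KΓ a Γ ⊢ [ φ ^ x ] ] ((Π ++ KΓ a Γ) ⊢ (K a φ ^ x ∷ Σ'))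
    cL : ∀ Γ Δ φ →
      Inst s [ (φ ^ unf ∷ (KCs φ ++ Γ)) ⊢ Δ ] ((C φ ^ unf ∷ Γ) ⊢ Δ)
    cR : ∀ Γ Δ φ x →
      Inst s ((Γ ⊢ (φ ^ unf ∷ Δ)) ∷
              map (λ a → Γ ⊢ (K a (C φ) ^ x ∷ Δ)) (allFin (suc n)))
             (Γ ⊢ (C φ ^ x ∷ Δ))

  IsCRfoc : ∀ {s ps ρ} → Inst s ps ρ → Set
  IsCRfoc (cR _ _ _ foc) = ⊤
  IsCRfoc _ = ⊥

  data Tree : Set where
    node : Seq n → List Tree → Tree

  label : Tree → Seq n
  label (node σ _) = σ

  children : Tree → List Tree
  children (node _ ts) = ts

  data Pos : Tree → Set where
    here  : ∀ {t} → Pos t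
    there : ∀ {σ ts} (i : Fin (length ts)) → Pos (lookup ts i) → Pos (node σ ts)

  sub : (t : Tree) → Pos t → Tree
  sub t here = t
  sub (node σ ts) (there i p) = sub (lookup ts i) p

  _⊕_ : ∀ {t} (p : Pos t) → Pos (sub t p) → Pos t
  here ⊕ r = r
  there i p ⊕ r = there i (p ⊕ r)

  StepWith : (s : Sys) → (∀ {ps ρ} → Inst s ps ρ → Set) → Tree → Set
  StepWith s P t =
    Σ (List (Seq n)) λ ps → Σ (Seq n) λ ρ → Σ (Inst s ps ρ) λ r →
      P r × (label t ≈S ρ) × Pointwise (λ c p → label c ≈S p) (children t) ps

  Step : Sys → Tree → Set
  Step s = StepWith s (λ _ → ⊤)

  AllOnPath : (Tree → Set) → (t : Tree) → Pos t → Set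
  AllOnPath P t here = P t
  AllOnPath P (node σ ts) (there i p) = P (node σ ts) × AllOnPath P (lookup ts i) p

  AnyAbove : (Tree → Set) → (t : Tree) → Pos t → Set
  AnyAbove P t here = ⊥
  AnyAbove P (node σ ts) (there i p) = P (node σ ts) ⊎ AnyAbove P (lookup ts i) p

  SuccessfulPath : Sys → (t : Tree) → Pos t → Set
  SuccessfulPath s t r =
    AllOnPath (λ c → HasFocus (label c)) t r × AnyAbove (StepWith s IsCRfoc) t r

  Bud : Sys → (t : Tree) → Pos t → Set
  Bud s t p = Σ (Pos t) λ u → Σ (Pos (sub t u)) λ r →
    (r ≢ here) × ((u ⊕ r) ≡ p) × (label (sub t u) ≈S label (sub t p)) ×
    SuccessfulPath s (sub t u) r

  CyclicProof : Sys → Seq n → Set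
  CyclicProof s σ = Σ Tree λ t →
    (label t ≈S σ) ×
    (∀ p → IsSequent (label (sub t p))) ×
    (∀ p → Step s (sub t p) ⊎ ((children (sub t p) ≡ []) × Bud s t p))

record Frame (n : ℕ) : Set₁ where
  field
    W        : Set
    inhabited : W
    _≤_      : W → W → Set
    ≤-refl   : ∀ {w} → w ≤ w
    ≤-trans  : ∀ {w v u} → w ≤ v → v ≤ u → w ≤ u
    ≤-antisym : ∀ {w v} → w ≤ v → v ≤ w → w ≡ v
    R        : Fin (suc n) → W → W → Set
    triangle : ∀ a {w v u} → w ≤ v → R a v u → R a w u

data FrameClass : Set where
  epistemic reflexive s4 : FrameClass

InClass : ∀ {n} → FrameClass → Frame n → Set
InClass epistemic F = ⊤
InClass reflexive F = ∀ a w → Frame.R F a w w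
InClass s4 F = (∀ a w → Frame.R F a w w) ×
               (∀ a {w v u} → Frame.R F a w v → Frame.R F a v u → Frame.R F a w u)

Valuation : ∀ {n} → Frame n → Set₁
Valuation F = ℕ → Frame.W F → Set

Monotone : ∀ {n} (F : Frame n) → Valuation F → Set
Monotone F V = ∀ p {w v} → Frame._≤_ F w v → V p w → V p v

module _ {n : ℕ} (F : Frame n) (V : Valuation F) where
  open Frame F

  Rall : W → W → Set
  Rall w v = ∃ λ a → R a w v

  sat : W → Fm n → Set
  sat w ⊥' = ⊥
  sat w (atom p) = V p w
  sat w (φ ∧ ψ) = sat w φ × sat w ψ
  sat w (φ ∨ ψ) = sat w φ ⊎ sat w ψ
  sat w (φ ⊃ ψ) = ∀ v → w ≤ v → sat v φ → sat v ψ
  sat w (K a φ) = ∀ v → R a w v → sat v φ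
  sat w (C φ) = ∀ v → Star Rall w v → sat v φ

⋀ : ∀ {n} → List (AFm n) → Fm n
⋀ [] = ⊥' ⊃ ⊥'
⋀ (χ ∷ Γ) = fm χ ∧ ⋀ Γ

⋁ : ∀ {n} → List (AFm n) → Fm n
⋁ [] = ⊥'
⋁ (χ ∷ Δ) = fm χ ∨ ⋁ Δ

ValidFm : ∀ {n} → FrameClass → Fm n → Set₁
ValidFm {n} cl φ = (F : Frame n) → InClass cl F →
  (V : Valuation F) → Monotone F V → (w : Frame.W F) → sat F V w φ

ValidSeq : ∀ {n} → FrameClass → Seq n → Set₁
ValidSeq cl σ = ValidFm cl (⋀ (ante σ) ⊃ ⋁ (succ σ))

{-# OPTIONS --safe #-}
module Submission where

-- Let cl be the closure of the formulae of σ under components. Starting from all pairs (Γ , Δ) of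
-- subsets of cl, repeatedly discard a pair that is not saturated or some formula of whose Δ cannot be
-- refuted within the remaining pairs. Every discarded saturated pair Γ ⇒ Δ has a cyclic proof, and the
-- pairs that remain form a model refuting each of their Δ; so either all saturated extensions of σ are
-- provable, and then σ is, or σ is not valid.
-- The crux is C φ in Δ such that no pair reachable from (Γ , Δ) refutes φ. Unfolding C φ in focus,
-- saturating, and applying the modal rules to K a (C φ) leads only through reachable pairs; at each of
-- them the premise for φ is provable, and the remaining branches return to an earlier antecedent.

open import Defs
open import Data.Nat using (ℕ; zero; suc; _≤_; _<_; s≤s⁻¹; _+_)
import Data.Nat.Properties as ℕ
open import Data.Fin using (Fin; zero; suc)
import Data.Fin.Properties as Fin
open import Data.List using (List; []; _∷_; [_]; _++_; map; length; lookup; allFin; filter; concatMap; cartesianProduct)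
open import Data.List.Properties using (map-∘; map-++; ++-identityʳ; filter-notAll; length-filter)
open import Data.List.Membership.Propositional using (_∈_; _∉_; find; lose)
open import Data.List.Membership.Propositional.Properties
open import Data.List.Relation.Binary.Subset.Propositional using (_⊆_)
import Data.List.Relation.Binary.Subset.Propositional.Properties as ⊆
open import Data.List.Relation.Binary.Pointwise using (Pointwise; []; _∷_)
open import Data.List.Relation.Unary.All as All using (All; []; _∷_)
import Data.List.Relation.Unary.All.Properties as All
open import Data.List.Relation.Unary.Any as Any using (Any; here; there; any?)
import Data.List.Relation.Unary.Any.Properties as Any
open import Data.Product using (Σ; _×_; _,_; ∃; proj₁; proj₂; uncurry)
open import Data.Sum using (_⊎_; inj₁; inj₂; [_,_]′)
open import Data.Empty using (⊥; ⊥-elim)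
open import Data.Unit using (⊤; tt)
open import Function using (_∘_; id)
open import Relation.Nullary using (Dec; yes; no; ¬_; ¬?)
open import Relation.Nullary.Decidable using (map′; _×-dec_; decidable-stable)
open import Relation.Binary.Construct.Closure.ReflexiveTransitive using (Star; ε; _◅_)
open import Relation.Binary.PropositionalEquality using (_≡_; _≢_; refl; sym; trans; cong; subst; cong₂)

-- Finite search

private variable
  A B : Set

allOrAny : {P Q : A → Set} (xs : List A) → (∀ {x} → x ∈ xs → P x ⊎ Q x) →
  (∀ {x} → x ∈ xs → P x) ⊎ (∃ λ x → x ∈ xs × Q x)
allOrAny [] _ = inj₁ λ ()
allOrAny (x ∷ xs) f with f (here refl) | allOrAny xs (f ∘ there)
... | inj₂ q | _ = inj₂ (x , here refl , q)
... | inj₁ _ | inj₂ (y , y∈ , q) = inj₂ (y , there y∈ , q)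
... | inj₁ p | inj₁ ps = inj₁ λ { (here refl) → p ; (there y∈) → ps y∈ }

search : {P : A → Set} → (∀ x → Dec (P x)) → (xs : List A) →
  (∀ {x} → x ∈ xs → ¬ P x) ⊎ (∃ λ x → x ∈ xs × P x)
search {P = P} P? xs = allOrAny xs λ {x} _ → decide (P? x)
  where
  decide : ∀ {x} → Dec (P x) → ¬ P x ⊎ P x
  decide (yes p) = inj₂ p
  decide (no ¬p) = inj₁ ¬p

remove : {x : A} {xs : List A} → x ∈ xs → ∃ λ ys →
  length xs ≡ suc (length ys) × (∀ {z} → z ∈ xs → z ≡ x ⊎ z ∈ ys) × ys ⊆ xs
remove {xs = _ ∷ xs} (here refl) =
  xs , refl , (λ { (here eq) → inj₁ eq ; (there z∈) → inj₂ z∈ }) , there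
remove {xs = y ∷ _} (there x∈) with remove x∈
... | ys , len , split , incl =
  y ∷ ys , cong suc len ,
  (λ { (here eq) → inj₂ (here eq) ; (there z∈) → [ inj₁ , inj₂ ∘ there ]′ (split z∈) }) ,
  λ { (here eq) → here eq ; (there z∈) → there (incl z∈) }

-- Each round either finds the current list stable or yields an element satisfying `G`, which is
-- removed, so the length bounds the number of rounds. The test receives the invariant because a
-- verdict may rest on earlier removals; `G` does not mention the list, so past verdicts stay true.
-- It serves both `reachability` and `survivors`.
eliminate : {G : A → Set} {P : List A → A → Set} (xs₀ : List A) →
  (∀ xs → xs ⊆ xs₀ → (∀ {x} → x ∈ xs₀ → G x ⊎ x ∈ xs) → ∀ {x} → x ∈ xs → P xs x ⊎ G x) →
  ∃ λ xs → xs ⊆ xs₀ × (∀ {x} → x ∈ xs₀ → G x ⊎ x ∈ xs) × (∀ {x} → x ∈ xs → P xs x)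
eliminate {A = A} {G = G} {P} xs₀ stableOrG = go (length xs₀) xs₀ ℕ.≤-refl id inj₂
  where
  go : ∀ k xs → length xs ≤ k → xs ⊆ xs₀ → (∀ {x} → x ∈ xs₀ → G x ⊎ x ∈ xs) →
    ∃ λ xs → xs ⊆ xs₀ × (∀ {x} → x ∈ xs₀ → G x ⊎ x ∈ xs) × (∀ {x} → x ∈ xs → P xs x)
  go k xs len incl inv with allOrAny xs (stableOrG xs incl inv)
  ... | inj₁ stable = xs , incl , inv , stable
  ... | inj₂ (x , x∈ , g) with remove x∈
  go zero xs len incl inv | inj₂ (x , x∈ , g) | ys , eq , _ with () ← subst (_≤ 0) eq len
  go (suc k) xs len incl inv | inj₂ (x , x∈ , g) | ys , eq , split , ys⊆xs =
    go k ys (s≤s⁻¹ (subst (_≤ suc k) eq len)) (incl ∘ ys⊆xs)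
      λ z∈ → [ inj₁ , (λ z∈xs → [ (λ { refl → inj₁ g }) , inj₂ ]′ (split z∈xs)) ]′ (inv z∈)

module _ (R : A → A → Set) (Q : A → Set) where

  data Reach (xs : List A) (x : A) : Set where
    here : Q x → Reach xs x
    step : ∀ {y} → y ∈ xs → R x y → Reach xs y → Reach xs x

  -- The local form of unreachability: when all members of `bad` are trapped, no path inside `xs`
  -- that starts in `bad` ever meets `Q`.
  Trapped : List A → List A → A → Set
  Trapped xs bad x = ¬ Q x × (∀ {y} → y ∈ xs → R x y → y ∈ bad)

  -- Points with a known path to `Q` are removed until none is left to remove. A remaining point
  -- then fails `Q` and has no removed successor, as such a successor would give it a path.
  reachability : (∀ x y → Dec (R x y)) → (∀ x → Dec (Q x)) → (xs : List A) →
    ∃ λ bad → bad ⊆ xs × (∀ {x} → x ∈ xs → Reach xs x ⊎ x ∈ bad) ×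
      (∀ {x} → x ∈ bad → Trapped xs bad x)
  reachability R? Q? xs = eliminate xs λ bad _ inv {x} _ → trappedOrReach bad inv x
    where
    successor : ∀ {bad x y} → y ∈ xs → Dec (R x y) → Reach xs y ⊎ y ∈ bad →
      (R x y → y ∈ bad) ⊎ (R x y × Reach xs y)
    successor y∈ (no ¬r) _ = inj₁ (⊥-elim ∘ ¬r)
    successor y∈ (yes r) (inj₁ reach) = inj₂ (r , reach)
    successor y∈ (yes r) (inj₂ y∈bad) = inj₁ λ _ → y∈bad

    trappedOrReach : ∀ bad → (∀ {x} → x ∈ xs → Reach xs x ⊎ x ∈ bad) →
      ∀ x → Trapped xs bad x ⊎ Reach xs x
    trappedOrReach bad inv x with Q? x
    ... | yes q = inj₂ (here q)
    ... | no ¬q with allOrAny xs (λ {y} y∈ → successor {bad} y∈ (R? x y) (inv y∈))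
    ...   | inj₁ trapped = inj₁ (¬q , trapped)
    ...   | inj₂ (y , y∈ , r , reach) = inj₂ (step y∈ r reach)

sublists : List A → List (List A)
sublists [] = [ [] ]
sublists (x ∷ xs) = map (x ∷_) (sublists xs) ++ sublists xs

filter∈sublists : {P : A → Set} (P? : ∀ x → Dec (P x)) (xs : List A) →
  filter P? xs ∈ sublists xs
filter∈sublists P? [] = here refl
filter∈sublists P? (x ∷ xs) with P? x
... | yes _ = ∈-++⁺ˡ (∈-map⁺ (x ∷_) (filter∈sublists P? xs))
... | no _ = ∈-++⁺ʳ (map (x ∷_) (sublists xs)) (filter∈sublists P? xs)

∈sublists⇒⊆ : (xs : List A) {ys : List A} → ys ∈ sublists xs → ys ⊆ xs
∈sublists⇒⊆ [] (here refl) = id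
∈sublists⇒⊆ (x ∷ xs) ys∈ with ∈-++⁻ (map (x ∷_) (sublists xs)) ys∈
... | inj₂ ys∈′ = there ∘ ∈sublists⇒⊆ xs ys∈′
... | inj₁ ys∈′ with ∈-map⁻ (x ∷_) ys∈′
...   | zs , zs∈ , refl = ⊆.∈-∷⁺ʳ (here refl) (there ∘ ∈sublists⇒⊆ xs zs∈)

-- Lists up to equal membership

≈L-refl : {xs : List A} → xs ≈L xs
≈L-refl = id , id

≈L-sym : {xs ys : List A} → xs ≈L ys → ys ≈L xs
≈L-sym (p , q) = q , p

≈L-trans : {xs ys zs : List A} → xs ≈L ys → ys ≈L zs → xs ≈L zs
≈L-trans (p , q) (p′ , q′) = p′ ∘ p , q ∘ q′

≈L-map : (f : A → B) {xs ys : List A} → xs ≈L ys → map f xs ≈L map f ys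
≈L-map f (p , q) = ⊆.map⁺ f p , ⊆.map⁺ f q

∈⇒≈∷ : {x : A} {xs : List A} → x ∈ xs → xs ≈L (x ∷ xs)
∈⇒≈∷ x∈ = there , ⊆.∈-∷⁺ʳ x∈ id

++-∷-≈L : (xs : List A) {y : A} {ys : List A} → (xs ++ y ∷ ys) ≈L (y ∷ xs ++ ys)
++-∷-≈L xs {y} {ys} = to , λ { (here eq) → ∈-++⁺ʳ xs (here eq) ; (there z∈) → ⊆.++⁺ʳ xs there z∈ }
  where
  to : xs ++ y ∷ ys ⊆ y ∷ xs ++ ys
  to z∈ with ∈-++⁻ xs z∈
  ... | inj₁ z∈xs = there (∈-++⁺ˡ z∈xs)
  ... | inj₂ (here eq) = here eq
  ... | inj₂ (there z∈ys) = there (∈-++⁺ʳ xs z∈ys)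

module _ {n : ℕ} where

  ≈S-refl : {σ : Seq n} → σ ≈S σ
  ≈S-refl = ≈L-refl , ≈L-refl

  ≈S-sym : {σ ρ : Seq n} → σ ≈S ρ → ρ ≈S σ
  ≈S-sym (p , q) = ≈L-sym p , ≈L-sym q

  ≈S-trans : {σ ρ τ : Seq n} → σ ≈S ρ → ρ ≈S τ → σ ≈S τ
  ≈S-trans (p , q) (p′ , q′) = ≈L-trans p p′ , ≈L-trans q q′

  IsSequent-resp : {σ ρ : Seq n} → σ ≈S ρ → IsSequent σ → IsSequent ρ
  IsSequent-resp ((_ , Γ⊇) , (_ , Δ⊇)) is = record
    { anteUnf = IsSequent.anteUnf is ∘ Γ⊇
    ; focShape = IsSequent.focShape is ∘ Δ⊇
    ; focOne = λ χ∈ χ'∈ → IsSequent.focOne is (Δ⊇ χ∈) (Δ⊇ χ'∈)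
    }

  HasFocus-resp : {σ ρ : Seq n} → σ ≈S ρ → HasFocus σ → HasFocus ρ
  HasFocus-resp (_ , Δ⊆ , _) (χ , χ∈ , eq) = χ , Δ⊆ χ∈ , eq

-- Derivations with open buds

module _ {n : ℕ} (s : Sys) where

  -- H lists the conclusions of those CR instances with principal formula in focus below the current
  -- sequent from which all sequents up to here carry a focus: exactly the companions of a successful bud.
  data Deriv (H : List (Seq n)) (σ : Seq n) : Set where
    closed : Deriv [] σ → Deriv H σ
    bud : ∀ {τ} → τ ∈ H → σ ≈S τ → IsSequent σ → HasFocus σ → Deriv H σ
    step : ∀ {ps ρ} → Inst s ps ρ → σ ≈S ρ → IsSequent σ → H ≡ [] ⊎ HasFocus σ →
      All (Deriv H) ps → Deriv H σ
    crFoc : ∀ {ps ρ} (r : Inst s ps ρ) → IsCRfoc r → σ ≈S ρ → IsSequent σ → HasFocus σ →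
      All (Deriv (ρ ∷ H)) ps → Deriv H σ

  Deriv-resp : ∀ {H σ σ′} → σ ≈S σ′ → Deriv H σ → Deriv H σ′
  Deriv-resp e (closed d) = closed (Deriv-resp e d)
  Deriv-resp e (bud τ∈ e′ is hf) =
    bud τ∈ (≈S-trans (≈S-sym e) e′) (IsSequent-resp e is) (HasFocus-resp e hf)
  Deriv-resp e (step r e′ is side ds) =
    step r (≈S-trans (≈S-sym e) e′) (IsSequent-resp e is)
      ([ inj₁ , inj₂ ∘ HasFocus-resp e ]′ side) ds
  Deriv-resp e (crFoc r isCR e′ is hf ds) =
    crFoc r isCR (≈S-trans (≈S-sym e) e′) (IsSequent-resp e is) (HasFocus-resp e hf) ds

  tree : ∀ {H σ} → Deriv H σ → Tree {n}
  trees : ∀ {H ps} → All (Deriv H) ps → List (Tree {n})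
  tree (closed d) = tree d
  tree {σ = σ} (bud _ _ _ _) = node σ []
  tree {σ = σ} (step _ _ _ _ ds) = node σ (trees ds)
  tree {σ = σ} (crFoc _ _ _ _ _ ds) = node σ (trees ds)
  trees [] = []
  trees (d ∷ ds) = tree d ∷ trees ds

  label-tree : ∀ {H σ} (d : Deriv H σ) → label (tree d) ≡ σ
  label-tree (closed d) = label-tree d
  label-tree (bud _ _ _ _) = refl
  label-tree (step _ _ _ _ _) = refl
  label-tree (crFoc _ _ _ _ _ _) = refl

  labels-trees : ∀ {H ps} (ds : All (Deriv H) ps) →
    Pointwise (λ c p → label c ≈S p) (trees ds) ps
  labels-trees [] = []
  labels-trees (_∷_ {x = p} d ds) =
    subst (_≈S p) (sym (label-tree d)) ≈S-refl ∷ labels-trees ds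

  tree-isSequent : ∀ {H σ} (d : Deriv H σ) (p : Pos (tree d)) → IsSequent (label (sub (tree d) p))
  trees-isSequent : ∀ {H ps} (ds : All (Deriv H) ps) (i : Fin (length (trees ds)))
    (p : Pos (lookup (trees ds) i)) → IsSequent (label (sub (lookup (trees ds) i) p))
  tree-isSequent (closed d) p = tree-isSequent d p
  tree-isSequent (bud _ _ is _) here = is
  tree-isSequent (step _ _ is _ _) here = is
  tree-isSequent (step _ _ _ _ ds) (there i p) = trees-isSequent ds i p
  tree-isSequent (crFoc _ _ _ is _ _) here = is
  tree-isSequent (crFoc _ _ _ _ _ ds) (there i p) = trees-isSequent ds i p
  trees-isSequent (d ∷ ds) zero p = tree-isSequent d p
  trees-isSequent (d ∷ ds) (suc i) p = trees-isSequent ds i p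

  -- A leaf whose companion still lies below the root of `t`. The focus along the path from that
  -- root is recorded, so that the path can be prolonged downwards one node at a time.
  OpenBud : List (Seq n) → (t : Tree {n}) → Pos t → Set
  OpenBud H t p = ∃ λ τ → τ ∈ H × label (sub t p) ≈S τ × AllOnPath (λ c → HasFocus (label c)) t p

  Justified : List (Seq n) → (t : Tree {n}) → Pos t → Set
  Justified H t p = Step s (sub t p) ⊎ ((children (sub t p) ≡ []) × (Bud s t p ⊎ OpenBud H t p))

  Bud-there : ∀ {σ} {ts : List (Tree {n})} (i : Fin (length ts)) {p} → Bud s (lookup ts i) p → Bud s (node σ ts) (there i p)
  Bud-there i (u , r , ne , eq , rest) = there i u , r , ne , cong (there i) eq , rest

  -- Buds that already have a companion in the subtree are merely shifted. For an open bud the side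
  -- condition of `step` supplies the focus at the new node; if instead `H` is empty, there is no
  -- open bud.
  Justified-step : ∀ {H σ} {ts : List (Tree {n})} (i : Fin (length ts)) {p} → H ≡ [] ⊎ HasFocus σ →
    Justified H (lookup ts i) p → Justified H (node σ ts) (there i p)
  Justified-step i side (inj₁ st) = inj₁ st
  Justified-step {ts = ts} i side (inj₂ (leaf , inj₁ b)) = inj₂ (leaf , inj₁ (Bud-there {ts = ts} i b))
  Justified-step i (inj₁ refl) (inj₂ (_ , inj₂ (_ , () , _)))
  Justified-step i (inj₂ hf) (inj₂ (leaf , inj₂ (τ , τ∈ , e , path))) =
    inj₂ (leaf , inj₂ (τ , τ∈ , e , hf , path))

  -- Here open buds are closed. One waiting for the conclusion of this very instance takes the root
  -- as companion: the path is non-empty, and its first node is the required CR instance in focus.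
  -- The other open buds are passed on.
  Justified-crFoc : ∀ {H σ ρ} {ts : List (Tree {n})} (i : Fin (length ts)) {p} → σ ≈S ρ → HasFocus σ →
    StepWith s IsCRfoc (node σ ts) →
    Justified (ρ ∷ H) (lookup ts i) p → Justified H (node σ ts) (there i p)
  Justified-crFoc i _ _ _ (inj₁ st) = inj₁ st
  Justified-crFoc {ts = ts} i _ _ _ (inj₂ (leaf , inj₁ b)) = inj₂ (leaf , inj₁ (Bud-there {ts = ts} i b))
  Justified-crFoc i {p} σ≈ρ hf cr (inj₂ (leaf , inj₂ (_ , here refl , e , path))) =
    inj₂ (leaf , inj₁ (here , there i p , (λ ()) , refl , ≈S-trans σ≈ρ (≈S-sym e) ,
      (hf , path) , inj₁ cr))
  Justified-crFoc i _ hf _ (inj₂ (leaf , inj₂ (τ , there τ∈ , e , path))) =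
    inj₂ (leaf , inj₂ (τ , τ∈ , e , hf , path))

  justified : ∀ {H σ} (d : Deriv H σ) (p : Pos (tree d)) → Justified H (tree d) p
  justified* : ∀ {H ps} (ds : All (Deriv H) ps) (i : Fin (length (trees ds)))
    (p : Pos (lookup (trees ds) i)) → Justified H (lookup (trees ds) i) p
  justified (closed d) p with justified d p
  ... | inj₁ st = inj₁ st
  ... | inj₂ (leaf , inj₁ b) = inj₂ (leaf , inj₁ b)
  justified (bud τ∈ e _ hf) here = inj₂ (refl , inj₂ (_ , τ∈ , e , hf))
  justified (step r e _ _ ds) here = inj₁ (_ , _ , r , tt , e , labels-trees ds)
  justified (step _ _ _ side ds) (there i p) = Justified-step i side (justified* ds i p)
  justified (crFoc r _ e _ _ ds) here = inj₁ (_ , _ , r , tt , e , labels-trees ds)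
  justified (crFoc r isCR e _ hf ds) (there i p) =
    Justified-crFoc i e hf (_ , _ , r , isCR , e , labels-trees ds) (justified* ds i p)
  justified* (d ∷ ds) zero p = justified d p
  justified* (d ∷ ds) (suc i) p = justified* ds i p

  Deriv⇒CyclicProof : ∀ {σ} → Deriv [] σ → CyclicProof s σ
  Deriv⇒CyclicProof {σ} d =
    tree d , subst (_≈S σ) (sym (label-tree d)) ≈S-refl , tree-isSequent d , λ p → noOpen (justified d p)
    where
    noOpen : ∀ {t p} → Justified [] t p → Step s (sub t p) ⊎ ((children (sub t p) ≡ []) × Bud s t p)
    noOpen (inj₁ st) = inj₁ st
    noOpen (inj₂ (leaf , inj₁ b)) = inj₂ (leaf , b)

-- Formulae and saturation

module _ {n : ℕ} where

  -- Comparing head constructors first spares the decision procedure the 42 mixed cases.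
  tag : Fm n → ℕ
  tag ⊥' = 0
  tag (atom _) = 1
  tag (_ ∧ _) = 2
  tag (_ ∨ _) = 3
  tag (_ ⊃ _) = 4
  tag (K _ _) = 5
  tag (C _) = 6

  infix 4 _≟_ _∈?_ _⊆?_
  _≟_ : (φ ψ : Fm n) → Dec (φ ≡ ψ)
  sameTag : (φ ψ : Fm n) → tag φ ≡ tag ψ → Dec (φ ≡ ψ)
  φ ≟ ψ with tag φ ℕ.≟ tag ψ
  ... | yes eq = sameTag φ ψ eq
  ... | no ne = no λ eq → ne (cong tag eq)
  sameTag ⊥' ⊥' _ = yes refl
  sameTag (atom p) (atom q) _ = map′ (cong atom) (λ { refl → refl }) (p ℕ.≟ q)
  sameTag (φ ∧ ψ) (φ' ∧ ψ') _ =
    map′ (uncurry (cong₂ _∧_)) (λ { refl → refl , refl }) ((φ ≟ φ') ×-dec (ψ ≟ ψ'))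
  sameTag (φ ∨ ψ) (φ' ∨ ψ') _ =
    map′ (uncurry (cong₂ _∨_)) (λ { refl → refl , refl }) ((φ ≟ φ') ×-dec (ψ ≟ ψ'))
  sameTag (φ ⊃ ψ) (φ' ⊃ ψ') _ =
    map′ (uncurry (cong₂ _⊃_)) (λ { refl → refl , refl }) ((φ ≟ φ') ×-dec (ψ ≟ ψ'))
  sameTag (K a φ) (K b ψ) _ =
    map′ (uncurry (cong₂ K)) (λ { refl → refl , refl }) ((a Fin.≟ b) ×-dec (φ ≟ ψ))
  sameTag (C φ) (C ψ) _ = map′ (cong C) (λ { refl → refl }) (φ ≟ ψ)

  _∈?_ : (φ : Fm n) (Γ : List (Fm n)) → Dec (φ ∈ Γ)
  φ ∈? Γ = any? (φ ≟_) Γ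

  _⊆?_ : (Γ Δ : List (Fm n)) → Dec (Γ ⊆ Δ)
  Γ ⊆? Δ = map′ All.lookup All.tabulate (All.all? (_∈? Δ) Γ)

  KCφs : Fm n → List (Fm n)
  KCφs φ = map (λ a → K a (C φ)) (allFin (suc n))

  components : Fm n → List (Fm n)
  components ⊥' = []
  components (atom _) = []
  components (φ ∧ ψ) = φ ∷ ψ ∷ []
  components (φ ∨ ψ) = φ ∷ ψ ∷ []
  components (φ ⊃ ψ) = φ ∷ ψ ∷ []
  components (K a φ) = φ ∷ []
  components (C φ) = φ ∷ KCφs φ

  -- The Fischer-Ladner closure. The formulae `K a (C φ)` are added by hand, because closing them
  -- recursively would lead back to `C φ`.
  closure : Fm n → List (Fm n)
  closure ⊥' = [ ⊥' ]
  closure (atom p) = [ atom p ]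
  closure (φ ∧ ψ) = (φ ∧ ψ) ∷ closure φ ++ closure ψ
  closure (φ ∨ ψ) = (φ ∨ ψ) ∷ closure φ ++ closure ψ
  closure (φ ⊃ ψ) = (φ ⊃ ψ) ∷ closure φ ++ closure ψ
  closure (K a φ) = K a φ ∷ closure φ
  closure (C φ) = C φ ∷ KCφs φ ++ closure φ

  ∈closure : ∀ φ → φ ∈ closure φ
  ∈closure ⊥' = here refl
  ∈closure (atom _) = here refl
  ∈closure (_ ∧ _) = here refl
  ∈closure (_ ∨ _) = here refl
  ∈closure (_ ⊃ _) = here refl
  ∈closure (K _ _) = here refl
  ∈closure (C _) = here refl

  Closed : List (Fm n) → Set
  Closed cl = ∀ {χ} → χ ∈ cl → components χ ⊆ cl

  closed-binary : ∀ φ ψ {χ} → components χ ≡ φ ∷ ψ ∷ [] → Closed (closure φ) → Closed (closure ψ) →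
    Closed (χ ∷ closure φ ++ closure ψ)
  closed-binary φ ψ eq _ _ (here refl) χ∈ with subst (_ ∈_) eq χ∈
  ... | here refl = there (∈-++⁺ˡ (∈closure φ))
  ... | there (here refl) = there (∈-++⁺ʳ (closure φ) (∈closure ψ))
  closed-binary φ ψ _ cφ cψ (there χ∈) with ∈-++⁻ (closure φ) χ∈
  ... | inj₁ χ∈φ = there ∘ ∈-++⁺ˡ ∘ cφ χ∈φ
  ... | inj₂ χ∈ψ = there ∘ ∈-++⁺ʳ (closure φ) ∘ cψ χ∈ψ

  closure-closed : ∀ φ → Closed (closure φ)
  closure-closed ⊥' (here refl) ()
  closure-closed (atom p) (here refl) ()
  closure-closed (φ ∧ ψ) = closed-binary φ ψ refl (closure-closed φ) (closure-closed ψ)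
  closure-closed (φ ∨ ψ) = closed-binary φ ψ refl (closure-closed φ) (closure-closed ψ)
  closure-closed (φ ⊃ ψ) = closed-binary φ ψ refl (closure-closed φ) (closure-closed ψ)
  closure-closed (K a φ) (here refl) (here refl) = there (∈closure φ)
  closure-closed (K a φ) (there χ∈) = there ∘ closure-closed φ χ∈
  closure-closed (C φ) (here refl) (here refl) = there (∈-++⁺ʳ (KCφs φ) (∈closure φ))
  closure-closed (C φ) (here refl) (there χ∈) = there (∈-++⁺ˡ χ∈)
  closure-closed (C φ) (there χ∈) with ∈-++⁻ (KCφs φ) χ∈
  ... | inj₂ χ∈φ = λ ψ∈ → there (∈-++⁺ʳ (KCφs φ) (closure-closed φ χ∈φ ψ∈))
  ... | inj₁ χ∈K with ∈-map⁻ _ χ∈K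
  ...   | a , _ , refl = λ { (here refl) → here refl }

  closures : List (Fm n) → List (Fm n)
  closures = concatMap closure

  closures-closed : ∀ Γ → Closed (closures Γ)
  closures-closed (φ ∷ Γ) χ∈ with ∈-++⁻ (closure φ) χ∈
  ... | inj₁ χ∈φ = ∈-++⁺ˡ ∘ closure-closed φ χ∈φ
  ... | inj₂ χ∈Γ = ∈-++⁺ʳ (closure φ) ∘ closures-closed Γ χ∈Γ

  ⊆closures : ∀ Γ → Γ ⊆ closures Γ
  ⊆closures (φ ∷ Γ) (here refl) = ∈-++⁺ˡ (∈closure φ)
  ⊆closures (φ ∷ Γ) (there χ∈) = ∈-++⁺ʳ (closure φ) (⊆closures Γ χ∈)

  unbox : Fin (suc n) → Fm n → List (Fm n)
  unbox a (K b φ) with a Fin.≟ b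
  ... | yes _ = [ φ ]
  ... | no _ = []
  unbox _ _ = []

  ∈unbox⁻ : ∀ {a φ} χ → φ ∈ unbox a χ → χ ≡ K a φ
  ∈unbox⁻ {a} (K b φ) φ∈ with a Fin.≟ b
  ∈unbox⁻ (K b φ) (here refl) | yes refl = refl

  ∈unbox⁺ : ∀ a φ → φ ∈ unbox a (K a φ)
  ∈unbox⁺ a φ with a Fin.≟ a
  ... | yes _ = here refl
  ... | no a≢a = ⊥-elim (a≢a refl)

  boxes : Fin (suc n) → List (Fm n) → List (Fm n)
  boxes a = concatMap (unbox a)

  ∈boxes⁻ : ∀ {a φ} Γ → φ ∈ boxes a Γ → K a φ ∈ Γ
  ∈boxes⁻ {a} (χ ∷ Γ) φ∈ with ∈-++⁻ (unbox a χ) φ∈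
  ... | inj₁ φ∈χ = here (sym (∈unbox⁻ χ φ∈χ))
  ... | inj₂ φ∈Γ = there (∈boxes⁻ Γ φ∈Γ)

  ∈boxes⁺ : ∀ {a φ} Γ → K a φ ∈ Γ → φ ∈ boxes a Γ
  ∈boxes⁺ {a} {φ} (χ ∷ Γ) (here refl) = ∈-++⁺ˡ (∈unbox⁺ a φ)
  ∈boxes⁺ {a} (χ ∷ Γ) (there Kφ∈) = ∈-++⁺ʳ (unbox a χ) (∈boxes⁺ Γ Kφ∈)

-- The three systems, their invertible rules and saturation

hasT? : ∀ s → Dec (HasT s)
hasT? ICK = no λ ()
hasT? ICKT = yes tICKT
hasT? ICKS4 = yes tICKS4

modal : ∀ s → HasK s ⊎ HasS4 s
modal ICK = inj₁ kICK
modal ICKT = inj₁ kICKT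
modal ICKS4 = inj₂ s4ICKS4

S4⇒T : ∀ {s} → HasS4 s → HasT s
S4⇒T s4ICKS4 = tICKS4

module _ {n : ℕ} (s : Sys) where

  -- The antecedent of the premise of the modal rule for K a, read off its conclusion.
  unboxed : Fin (suc n) → List (Fm n) → List (Fm n)
  unboxed a Γ = [ (λ _ → boxes a Γ) , (λ _ → map (K a) (boxes a Γ)) ]′ (modal s)

  -- This monotonicity later yields the triangle confluence of the model.
  unboxed-mono : ∀ {a Γ Γ′} → Γ ⊆ Γ′ → unboxed a Γ ⊆ unboxed a Γ′
  unboxed-mono {Γ = Γ} {Γ′} Γ⊆ with modal s
  ... | inj₁ _ = ∈boxes⁺ Γ′ ∘ Γ⊆ ∘ ∈boxes⁻ Γ
  ... | inj₂ _ = ⊆.map⁺ (K _) (∈boxes⁺ Γ′ ∘ Γ⊆ ∘ ∈boxes⁻ Γ)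

  unboxed-closed : ∀ {cl a Γ} → Closed cl → Γ ⊆ cl → unboxed a Γ ⊆ cl
  unboxed-closed {Γ = Γ} cl-closed Γ⊆ φ∈ with modal s
  ... | inj₁ _ = cl-closed (Γ⊆ (∈boxes⁻ Γ φ∈)) (here refl)
  ... | inj₂ _ with ∈-map⁻ _ φ∈
  ...   | ψ , ψ∈ , refl = Γ⊆ (∈boxes⁻ Γ ψ∈)

  -- The invertible rules: each alternative lists what a premise adds to the antecedent and to the succedent.
  Alternatives : Set
  Alternatives = List (List (Fm n) × List (Fm n))

  trivial : Alternatives
  trivial = [ [] , [] ]

  -- `⊥'` has no alternative, so no saturated antecedent contains it. A formula without an
  -- invertible rule gets `trivial`, which is always met.
  altsL : Fm n → Alternatives
  altsL ⊥' = []
  altsL (atom _) = trivial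
  altsL (φ ∧ ψ) = [ φ ∷ ψ ∷ [] , [] ]
  altsL (φ ∨ ψ) = ([ φ ] , []) ∷ ([ ψ ] , []) ∷ []
  altsL (φ ⊃ ψ) = ([] , [ φ ]) ∷ ([ ψ ] , []) ∷ []
  altsL (K a φ) with hasT? s
  ... | yes _ = [ [ φ ] , [] ]
  ... | no _ = trivial
  altsL (C φ) = [ φ ∷ KCφs φ , [] ]

  -- Implications and boxes fall under `trivial`: their right rules discard the rest of the
  -- succedent. They are dealt with by `Demand`.
  altsR : Fm n → Alternatives
  altsR (φ ∧ ψ) = ([] , [ φ ]) ∷ ([] , [ ψ ]) ∷ []
  altsR (φ ∨ ψ) = [ [] , φ ∷ ψ ∷ [] ]
  altsR (C φ) = ([] , [ φ ]) ∷ map (λ a → [] , [ K a (C φ) ]) (allFin (suc n))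
  altsR _ = trivial

  altsL⊆components : ∀ χ {A B} → (A , B) ∈ altsL χ → A ⊆ components χ × B ⊆ components χ
  altsL⊆components (atom _) (here refl) = (λ ()) , λ ()
  altsL⊆components (φ ∧ ψ) (here refl) = id , λ ()
  altsL⊆components (φ ∨ ψ) (here refl) = (λ { (here eq) → here eq }) , λ ()
  altsL⊆components (φ ∨ ψ) (there (here refl)) = there , λ ()
  altsL⊆components (φ ⊃ ψ) (here refl) = (λ ()) , λ { (here eq) → here eq }
  altsL⊆components (φ ⊃ ψ) (there (here refl)) = there , λ ()
  altsL⊆components (K a φ) AB∈ with hasT? s
  altsL⊆components (K a φ) (here refl) | yes _ = id , λ ()
  altsL⊆components (K a φ) (here refl) | no _ = (λ ()) , λ ()
  altsL⊆components (C φ) (here refl) = id , λ ()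

  altsR⊆components : ∀ χ {A B} → (A , B) ∈ altsR χ → A ⊆ components χ × B ⊆ components χ
  altsR⊆components ⊥' (here refl) = (λ ()) , λ ()
  altsR⊆components (atom _) (here refl) = (λ ()) , λ ()
  altsR⊆components (φ ∧ ψ) (here refl) = (λ ()) , λ { (here eq) → here eq }
  altsR⊆components (φ ∧ ψ) (there (here refl)) = (λ ()) , there
  altsR⊆components (φ ∨ ψ) (here refl) = (λ ()) , id
  altsR⊆components (φ ⊃ ψ) (here refl) = (λ ()) , λ ()
  altsR⊆components (K a φ) (here refl) = (λ ()) , λ ()
  altsR⊆components (C φ) (here refl) = (λ ()) , λ { (here eq) → here eq }
  altsR⊆components (C φ) (there AB∈) with ∈-map⁻ _ AB∈
  ... | a , a∈ , refl = (λ ()) , λ { (here refl) → there (∈-map⁺ _ a∈) }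

  Met : List (Fm n) → List (Fm n) → Alternatives → Set
  Met Γ Δ = Any λ (A , B) → A ⊆ Γ × B ⊆ Δ

  met? : ∀ Γ Δ alts → Dec (Met Γ Δ alts)
  met? Γ Δ = any? λ (A , B) → (A ⊆? Γ) ×-dec (B ⊆? Δ)

  Saturated : List (Fm n) → List (Fm n) → Set
  Saturated Γ Δ = (∀ {χ} → χ ∈ Γ → Met Γ Δ (altsL χ)) × (∀ {χ} → χ ∈ Δ → Met Γ Δ (altsR χ)) ×
    (∀ {χ} → χ ∈ Γ → χ ∉ Δ)

  Saturated-resp : ∀ {Γ Γ′ Δ Δ′} → Γ ≈L Γ′ → Δ ≈L Δ′ → Saturated Γ Δ → Saturated Γ′ Δ′
  Saturated-resp {Γ} {Γ′} {Δ} {Δ′} (Γ⊆ , Γ⊇) (Δ⊆ , Δ⊇) (l , r , consistent) =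
    mono ∘ l ∘ Γ⊇ , mono ∘ r ∘ Δ⊇ , λ χ∈Γ χ∈Δ → consistent (Γ⊇ χ∈Γ) (Δ⊇ χ∈Δ)
    where
    mono : ∀ {alts} → Met Γ Δ alts → Met Γ′ Δ′ alts
    mono = Any.map λ (A⊆ , B⊆) → Γ⊆ ∘ A⊆ , Δ⊆ ∘ B⊆

  data Defect (Γ Δ : List (Fm n)) : Set where
    left : ∀ {χ} → χ ∈ Γ → ¬ Met Γ Δ (altsL χ) → Defect Γ Δ
    right : ∀ {χ} → χ ∈ Δ → ¬ Met Γ Δ (altsR χ) → Defect Γ Δ
    clash : ∀ {χ} → χ ∈ Γ → χ ∈ Δ → Defect Γ Δ

  ¬saturated : ∀ {Γ Δ} → Defect Γ Δ → ¬ Saturated Γ Δ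
  ¬saturated (left χ∈ ¬met) (l , _) = ¬met (l χ∈)
  ¬saturated (right χ∈ ¬met) (_ , r , _) = ¬met (r χ∈)
  ¬saturated (clash χ∈Γ χ∈Δ) (_ , _ , consistent) = consistent χ∈Γ χ∈Δ

  saturatedOrDefect : ∀ Γ Δ → Saturated Γ Δ ⊎ Defect Γ Δ
  saturatedOrDefect Γ Δ
    with search (λ χ → ¬? (met? Γ Δ (altsL χ))) Γ
       | search (λ χ → ¬? (met? Γ Δ (altsR χ))) Δ
       | search (_∈? Δ) Γ
  ... | inj₂ (_ , χ∈ , ¬met) | _ | _ = inj₂ (left χ∈ ¬met)
  ... | inj₁ _ | inj₂ (_ , χ∈ , ¬met) | _ = inj₂ (right χ∈ ¬met)
  ... | inj₁ _ | inj₁ _ | inj₂ (_ , χ∈Γ , χ∈Δ) = inj₂ (clash χ∈Γ χ∈Δ)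
  ... | inj₁ l | inj₁ r | inj₁ consistent =
    inj₁ (decidable-stable (met? Γ Δ _) ∘ l , decidable-stable (met? Γ Δ _) ∘ r , consistent)

  module _ {cl : List (Fm n)} (cl-closed : Closed cl) (T : List (Fm n) → List (Fm n) → Set)
    (ruleL : ∀ {Γ Δ χ} → χ ∈ Γ → (∀ {A B} → (A , B) ∈ altsL χ → T (A ++ Γ) (B ++ Δ)) → T Γ Δ)
    (ruleR : ∀ {Γ Δ χ} → χ ∈ Δ → (∀ {A B} → (A , B) ∈ altsR χ → T (A ++ Γ) (B ++ Δ)) → T Γ Δ)
    (axiom : ∀ {Γ Δ χ} → χ ∈ Γ → χ ∈ Δ → T Γ Δ) where

    private
      -- `xs` covers what `Γ` still lacks of `cl`; its length is the termination measure of
      -- saturation.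
      Rest : List (Fm n) → List (Fm n) → Set
      Rest Γ xs = ∀ {χ} → χ ∈ cl → χ ∈ Γ ⊎ χ ∈ xs

      without : List (Fm n) → List (Fm n) → List (Fm n)
      without A = filter (λ χ → ¬? (χ ∈? A))

      without-rest : ∀ {Γ xs} A → Rest Γ xs → Rest (A ++ Γ) (without A xs)
      without-rest A rest {χ} χ∈ with χ ∈? A
      ... | yes χ∈A = inj₁ (∈-++⁺ˡ χ∈A)
      ... | no χ∉A with rest χ∈
      ...   | inj₁ χ∈Γ = inj₁ (∈-++⁺ʳ A χ∈Γ)
      ...   | inj₂ χ∈xs = inj₂ (∈-filter⁺ _ χ∈xs χ∉A)

      without-≤ : ∀ A xs → length (without A xs) ≤ length xs
      without-≤ A = length-filter _

      without-< : ∀ {A Γ xs} → Rest Γ xs → A ⊆ cl → ¬ (A ⊆ Γ) → length (without A xs) < length xs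
      without-< {A} {Γ} {xs} rest A⊆cl A⊈Γ with search (λ χ → ¬? (χ ∈? Γ)) A
      ... | inj₁ A⊆Γ = ⊥-elim (A⊈Γ (decidable-stable (_ ∈? Γ) ∘ A⊆Γ))
      ... | inj₂ (χ , χ∈A , χ∉Γ) with rest (A⊆cl χ∈A)
      ...   | inj₁ χ∈Γ = ⊥-elim (χ∉Γ χ∈Γ)
      ...   | inj₂ χ∈xs = filter-notAll _ xs (lose χ∈xs (λ χ∉A → χ∉A χ∈A))

      shorter : ∀ {A B Γ Δ xs ys} → Rest Γ xs → Rest Δ ys → A ⊆ cl → B ⊆ cl → ¬ (A ⊆ Γ × B ⊆ Δ) →
        length (without A xs) + length (without B ys) < length xs + length ys
      shorter {A} {B} {Γ} {xs = xs} {ys} restL restR A⊆ B⊆ new with A ⊆? Γ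
      ... | no A⊈ = ℕ.+-mono-<-≤ (without-< restL A⊆ A⊈) (without-≤ B ys)
      ... | yes A⊆Γ = ℕ.+-mono-≤-< (without-≤ A xs) (without-< restR B⊆ (λ B⊆Δ → new (A⊆Γ , B⊆Δ)))

    -- Rules are applied backwards with the principal formula kept, so both sides only grow inside
    -- `cl`. A rule is used only when none of its alternatives is met, hence every premise adds a
    -- new formula on some side and the measure drops. `T` is abstract so that one argument covers
    -- derivations with and without focus.
    saturate : ∀ {Γ₀ Δ₀} → Γ₀ ⊆ cl → Δ₀ ⊆ cl →
      (∀ {Γ Δ} → Γ₀ ⊆ Γ → Δ₀ ⊆ Δ → Γ ⊆ cl → Δ ⊆ cl → Saturated Γ Δ → T Γ Δ) → T Γ₀ Δ₀
    saturate {Γ₀} {Δ₀} Γ₀⊆cl Δ₀⊆cl leaf =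
      go (suc (length cl + length cl)) cl cl ℕ.≤-refl inj₂ inj₂ id id Γ₀⊆cl Δ₀⊆cl
      where
      go : ∀ k xs ys {Γ Δ} → length xs + length ys < k → Rest Γ xs → Rest Δ ys →
        Γ₀ ⊆ Γ → Δ₀ ⊆ Δ → Γ ⊆ cl → Δ ⊆ cl → T Γ Δ
      go (suc k) xs ys {Γ} {Δ} len restL restR Γ₀⊆ Δ₀⊆ Γ⊆ Δ⊆ = by (saturatedOrDefect Γ Δ)
        where
        extend : ∀ χ {alts} → (∀ {A B} → (A , B) ∈ alts → A ⊆ components χ × B ⊆ components χ) →
          χ ∈ cl → ¬ Met Γ Δ alts → ∀ {A B} → (A , B) ∈ alts → T (A ++ Γ) (B ++ Δ)
        extend χ alts⊆ χ∈ ¬met {A} {B} AB∈ =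
          go k (without A xs) (without B ys)
            (ℕ.<-≤-trans (shorter restL restR A⊆ B⊆ (¬met ∘ lose AB∈)) (s≤s⁻¹ len))
            (without-rest A restL) (without-rest B restR)
            (∈-++⁺ʳ A ∘ Γ₀⊆) (∈-++⁺ʳ B ∘ Δ₀⊆) (++-⊆ A A⊆ Γ⊆) (++-⊆ B B⊆ Δ⊆)
          where
          A⊆ : A ⊆ cl
          A⊆ = cl-closed χ∈ ∘ proj₁ (alts⊆ AB∈)
          B⊆ : B ⊆ cl
          B⊆ = cl-closed χ∈ ∘ proj₂ (alts⊆ AB∈)
          ++-⊆ : ∀ A {Γ} → A ⊆ cl → Γ ⊆ cl → A ++ Γ ⊆ cl
          ++-⊆ A A⊆ Γ⊆ χ∈ = [ A⊆ , Γ⊆ ]′ (∈-++⁻ A χ∈)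
        by : Saturated Γ Δ ⊎ Defect Γ Δ → T Γ Δ
        by (inj₁ sat) = leaf Γ₀⊆ Δ₀⊆ Γ⊆ Δ⊆ sat
        by (inj₂ (left {χ} χ∈ ¬met)) = ruleL χ∈ (extend χ (altsL⊆components χ) (Γ⊆ χ∈) ¬met)
        by (inj₂ (right {χ} χ∈ ¬met)) = ruleR χ∈ (extend χ (altsR⊆components χ) (Δ⊆ χ∈) ¬met)
        by (inj₂ (clash χ∈Γ χ∈Δ)) = axiom χ∈Γ χ∈Δ

-- Derivations of saturable sequents

module _ {n : ℕ} (s : Sys) where

  unfocus : List (Fm n) → List (AFm n)
  unfocus = map (_^ unf)

  sequent : List (AFm n) → List (Fm n) → List (Fm n) → Seq n
  sequent Φ Γ Δ = unfocus Γ ⊢ (unfocus Δ ++ Φ)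

  -- The focused part of a succedent is kept apart from the list being saturated. Without focus no
  -- companion can be used, whence the empty `H`; this matches the side condition of `step`.
  data Mode (H : List (Seq n)) : List (AFm n) → Set where
    unfocused : H ≡ [] → Mode H []
    focused : ∀ {χ} → FocShape χ → Mode H [ χ ^ foc ]

  ∈unfocus⁻ : ∀ {χ} Γ → χ ∈ unfocus Γ → ann χ ≡ unf
  ∈unfocus⁻ Γ χ∈ with ∈-map⁻ (_^ unf) χ∈
  ... | _ , _ , refl = refl

  sequent-resp : ∀ {Φ Γ Γ′ Δ Δ′} → Γ ≈L Γ′ → Δ ≈L Δ′ → sequent Φ Γ Δ ≈S sequent Φ Γ′ Δ′
  sequent-resp {Φ} Γ≈ (Δ⊆ , Δ⊇) =
    ≈L-map (_^ unf) Γ≈ , ⊆.++⁺ˡ Φ (⊆.map⁺ (_^ unf) Δ⊆) , ⊆.++⁺ˡ Φ (⊆.map⁺ (_^ unf) Δ⊇)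

  isSequent : ∀ {H Φ} → Mode H Φ → ∀ Γ Δ → IsSequent (sequent Φ Γ Δ)
  isSequent {Φ = Φ} m Γ Δ = record
    { anteUnf = ∈unfocus⁻ Γ
    ; focShape = λ χ∈ χfoc → shape m (inΦ χ∈ χfoc)
    ; focOne = λ χ∈ χ'∈ χfoc χ'foc → unique m (inΦ χ∈ χfoc) (inΦ χ'∈ χ'foc)
    }
    where
    inΦ : ∀ {χ} → χ ∈ unfocus Δ ++ Φ → ann χ ≡ foc → χ ∈ Φ
    inΦ χ∈ χfoc with ∈-++⁻ (unfocus Δ) χ∈
    ... | inj₂ χ∈Φ = χ∈Φ
    ... | inj₁ χ∈Δ with () ← trans (sym (∈unfocus⁻ Δ χ∈Δ)) χfoc
    shape : ∀ {H Φ χ} → Mode H Φ → χ ∈ Φ → FocShape (fm χ)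
    shape (focused sh) (here refl) = sh
    unique : ∀ {H Φ χ χ'} → Mode H Φ → χ ∈ Φ → χ' ∈ Φ → χ ≡ χ'
    unique (focused _) (here refl) (here refl) = refl

  hasFocus : ∀ {χ} Γ Δ → HasFocus (sequent [ χ ^ foc ] Γ Δ)
  hasFocus Γ Δ = _ , ∈-++⁺ʳ (unfocus Δ) (here refl) , refl

  infer : ∀ {H Φ ps ρ Γ Δ} → Mode H Φ → Inst s ps ρ → sequent Φ Γ Δ ≈S ρ → All (Deriv s H) ps →
    Deriv s H (sequent Φ Γ Δ)
  infer {Γ = Γ} {Δ} m r e = step r e (isSequent m Γ Δ) (side m)
    where
    side : ∀ {H Φ} → Mode H Φ → H ≡ [] ⊎ HasFocus (sequent Φ Γ Δ)
    side (unfocused eq) = inj₁ eq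
    side (focused _) = inj₂ (hasFocus Γ Δ)

  module _ {H Φ} (m : Mode H Φ) where

    -- Sequents are sets, so the principal formula may also count as a side formula. Contraction is
    -- thus built in, and premises keep what was decomposed.
    principalL : ∀ {χ Γ Δ} → χ ∈ Γ → sequent Φ Γ Δ ≈S ((χ ^ unf ∷ unfocus Γ) ⊢ (unfocus Δ ++ Φ))
    principalL χ∈ = ∈⇒≈∷ (∈-map⁺ (_^ unf) χ∈) , ≈L-refl

    principalR : ∀ {χ Γ Δ} → χ ∈ Δ → sequent Φ Γ Δ ≈S (unfocus Γ ⊢ (χ ^ unf ∷ unfocus Δ ++ Φ))
    principalR χ∈ = ≈L-refl , ∈⇒≈∷ (∈-++⁺ˡ (∈-map⁺ (_^ unf) χ∈))

    invertibleL : ∀ {Γ Δ χ} → χ ∈ Γ →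
      (∀ {A B} → (A , B) ∈ altsL s χ → Deriv s H (sequent Φ (A ++ Γ) (B ++ Δ))) → Deriv s H (sequent Φ Γ Δ)
    invertibleL {χ = ⊥'} χ∈ _ = infer m (botL _ _) (principalL χ∈) []
    invertibleL {χ = atom _} _ ds = ds (here refl)
    invertibleL {χ = φ ∧ ψ} χ∈ ds = infer m (andL _ _ φ ψ) (principalL χ∈) (ds (here refl) ∷ [])
    invertibleL {χ = φ ∨ ψ} χ∈ ds =
      infer m (orL _ _ φ ψ) (principalL χ∈) (ds (here refl) ∷ ds (there (here refl)) ∷ [])
    invertibleL {χ = φ ⊃ ψ} χ∈ ds =
      infer m (impL _ _ φ ψ) (principalL χ∈) (ds (here refl) ∷ ds (there (here refl)) ∷ [])
    invertibleL {χ = K a φ} χ∈ ds with hasT? s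
    ... | yes t = infer m (tRule t a _ _ φ) (principalL χ∈) (ds (here refl) ∷ [])
    ... | no _ = ds (here refl)
    invertibleL {Γ} {Δ} {χ = C φ} χ∈ ds = infer m (cL _ _ φ) (principalL χ∈)
      (subst (λ Θ → Deriv s H ((φ ^ unf ∷ Θ) ⊢ (unfocus Δ ++ Φ))) unfocus-KCφs (ds (here refl)) ∷ [])
      where
      unfocus-KCφs : unfocus (KCφs φ ++ Γ) ≡ KCs φ ++ unfocus Γ
      unfocus-KCφs = trans (map-++ (_^ unf) (KCφs φ) Γ)
        (cong (_++ unfocus Γ) (sym (map-∘ (allFin (suc n)))))

    invertibleR : ∀ {Γ Δ χ} → χ ∈ Δ →
      (∀ {A B} → (A , B) ∈ altsR s χ → Deriv s H (sequent Φ (A ++ Γ) (B ++ Δ))) → Deriv s H (sequent Φ Γ Δ)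
    invertibleR {χ = ⊥'} _ ds = ds (here refl)
    invertibleR {χ = atom _} _ ds = ds (here refl)
    invertibleR {χ = φ ∧ ψ} χ∈ ds =
      infer m (andR _ _ φ ψ) (principalR χ∈) (ds (here refl) ∷ ds (there (here refl)) ∷ [])
    invertibleR {χ = φ ∨ ψ} χ∈ ds = infer m (orR _ _ φ ψ) (principalR χ∈) (ds (here refl) ∷ [])
    invertibleR {χ = φ ⊃ ψ} _ ds = ds (here refl)
    invertibleR {χ = K _ _} _ ds = ds (here refl)
    invertibleR {χ = C φ} χ∈ ds = infer m (cR _ _ φ unf) (principalR χ∈)
      (ds (here refl) ∷ All.map⁺ (All.universal (λ a → ds (there (∈-map⁺ _ (∈-allFin a)))) (allFin (suc n))))

    identity : ∀ {Γ Δ χ} → χ ∈ Γ → χ ∈ Δ → Deriv s H (sequent Φ Γ Δ)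
    identity {χ = χ} χ∈Γ χ∈Δ =
      infer m (idAx _ _ χ unf) (proj₁ (principalL {Δ = []} χ∈Γ) , proj₂ (principalR {Γ = []} χ∈Δ)) []

  -- This lets the modal rules be applied with the whole antecedent as the weakened context `Π`.
  KΓ-absorbed : ∀ a Γ → unfocus Γ ≈L (unfocus Γ ++ KΓ a (unfocus (boxes a Γ)))
  KΓ-absorbed a Γ = ∈-++⁺ˡ , λ χ∈ → [ id , boxed ]′ (∈-++⁻ (unfocus Γ) χ∈)
    where
    boxed : KΓ a (unfocus (boxes a Γ)) ⊆ unfocus Γ
    boxed χ∈ with ∈-map⁻ _ χ∈
    ... | _ , χ′∈ , refl with ∈-map⁻ _ χ′∈
    ...   | ψ , ψ∈ , refl = ∈-map⁺ (_^ unf) (∈boxes⁻ Γ ψ∈)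

  modalStep : ∀ {H Φ Γ Δ a φ x Σ′} → Mode H Φ → (unfocus Δ ++ Φ) ≈L (K a φ ^ x ∷ Σ′) →
    Deriv s H (unfocus (unboxed s a Γ) ⊢ [ φ ^ x ]) → Deriv s H (sequent Φ Γ Δ)
  modalStep {H} {Γ = Γ} {a = a} {φ} {x} m Δ≈ d with modal s
  ... | inj₁ hasK =
    infer m (kRule hasK a (unfocus (boxes a Γ)) (unfocus Γ) _ φ x) (KΓ-absorbed a Γ , Δ≈) (d ∷ [])
  ... | inj₂ hasS4 =
    infer m (s4Rule hasS4 a (unfocus (boxes a Γ)) (unfocus Γ) _ φ x) (KΓ-absorbed a Γ , Δ≈)
      (subst (λ Θ → Deriv s H (Θ ⊢ [ φ ^ x ])) (trans (sym (map-∘ (boxes a Γ))) (map-∘ (boxes a Γ))) d ∷ [])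

  -- Elimination of pairs

  Pair : Set
  Pair = List (Fm n) × List (Fm n)

  Provable : Pair → Set
  Provable (Γ , Δ) = Deriv s [] (sequent [] Γ Δ)

  Accessible : Fin (suc n) → Pair → Pair → Set
  Accessible a (Γ , _) (Γ′ , _) = unboxed s a Γ ⊆ Γ′

  SomeAccessible : Pair → Pair → Set
  SomeAccessible v w = ∃ λ a → Accessible a v w

  Refutes : Fm n → Pair → Set
  Refutes φ (_ , Δ) = φ ∈ Δ

  -- What refuting a succedent formula requires beyond saturation: a witness among the living pairs,
  -- and for `C φ` a finite path to one. The remaining connectives are handled by saturation alone.
  Demand : List Pair → Pair → Fm n → Set
  Demand alive (Γ , _) (φ ⊃ ψ) = Σ Pair λ (Γ′ , Δ′) → (Γ′ , Δ′) ∈ alive × Γ ⊆ Γ′ × φ ∈ Γ′ × ψ ∈ Δ′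
  Demand alive w (K a φ) = Σ Pair λ v → v ∈ alive × Accessible a w v × Refutes φ v
  Demand alive w (C φ) = Reach SomeAccessible (Refutes φ) alive w
  Demand _ _ _ = ⊤

  Good : List Pair → Pair → Set
  Good alive (Γ , Δ) = Saturated s Γ Δ × (∀ {χ} → χ ∈ Δ → Demand alive (Γ , Δ) χ)

  module _ {cl : List (Fm n)} (cl-closed : Closed cl) where

    pairs : List Pair
    pairs = cartesianProduct (sublists cl) (sublists cl)

    -- Fixes order and repetitions, so that every antecedent or succedent inside `cl` has a
    -- set-equal copy among the finitely many sublists.
    canonical : List (Fm n) → List (Fm n)
    canonical Γ = filter (_∈? Γ) cl

    canonical-≈ : ∀ {Γ} → Γ ⊆ cl → Γ ≈L canonical Γ
    canonical-≈ {Γ} Γ⊆ = (λ χ∈ → ∈-filter⁺ (_∈? Γ) (Γ⊆ χ∈) χ∈) , proj₂ ∘ ∈-filter⁻ (_∈? Γ) {xs = cl}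

    -- Vacuous for an unsaturated pair, which may therefore be discarded at once.
    Settled : Pair → Set
    Settled (Γ , Δ) = Saturated s Γ Δ → Provable (Γ , Δ)

    module _ {alive : List Pair} (alive⊆ : alive ⊆ pairs)
      (settledOrAlive : ∀ {w} → w ∈ pairs → Settled w ⊎ w ∈ alive) where

      alive⊆cl : ∀ {Γ Δ} → (Γ , Δ) ∈ alive → Γ ⊆ cl × Δ ⊆ cl
      alive⊆cl w∈ with ∈-cartesianProduct⁻ (sublists cl) (sublists cl) (alive⊆ w∈)
      ... | Γ∈ , Δ∈ = ∈sublists⇒⊆ cl Γ∈ , ∈sublists⇒⊆ cl Δ∈

      verdict : ∀ {Γ Δ} → Γ ⊆ cl → Δ ⊆ cl → Saturated s Γ Δ →
        Provable (Γ , Δ) ⊎ Σ Pair λ (Γ′ , Δ′) → (Γ′ , Δ′) ∈ alive × Γ ≈L Γ′ × Δ ≈L Δ′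
      verdict {Γ} {Δ} Γ⊆ Δ⊆ sat
        with settledOrAlive (∈-cartesianProduct⁺ (filter∈sublists (_∈? Γ) cl) (filter∈sublists (_∈? Δ) cl))
      ... | inj₂ alive∈ = inj₂ (_ , alive∈ , canonical-≈ Γ⊆ , canonical-≈ Δ⊆)
      ... | inj₁ settled = inj₁ (Deriv-resp s (≈S-sym (sequent-resp (canonical-≈ Γ⊆) (canonical-≈ Δ⊆)))
                                  (settled (Saturated-resp s (canonical-≈ Γ⊆) (canonical-≈ Δ⊆) sat)))

      -- Saturate the sequent: by `verdict`, each leaf is either provable already or set-equal to a
      -- living pair extending `Γ` and `Δ`, and the hypothesis excludes the latter. This turns the
      -- absence of a witness into a proof of the premise of a rule.
      provable : ∀ {Γ Δ} → Γ ⊆ cl → Δ ⊆ cl →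
        (∀ {Γ′ Δ′} → (Γ′ , Δ′) ∈ alive → Γ ⊆ Γ′ → Δ ⊆ Δ′ → ⊥) → Provable (Γ , Δ)
      provable {Γ} {Δ} Γ⊆cl Δ⊆cl none =
        saturate s cl-closed (λ Γ Δ → Provable (Γ , Δ))
          (invertibleL (unfocused refl)) (invertibleR (unfocused refl)) (identity (unfocused refl))
          Γ⊆cl Δ⊆cl leaf
        where
        leaf : ∀ {Γ′ Δ′} → Γ ⊆ Γ′ → Δ ⊆ Δ′ → Γ′ ⊆ cl → Δ′ ⊆ cl → Saturated s Γ′ Δ′ → Provable (Γ′ , Δ′)
        leaf Γ⊆ Δ⊆ Γ′⊆cl Δ′⊆cl sat with verdict Γ′⊆cl Δ′⊆cl sat
        ... | inj₁ d = d
        ... | inj₂ (_ , v∈ , Γ≈ , Δ≈) = ⊥-elim (none v∈ (proj₁ Γ≈ ∘ Γ⊆) (proj₁ Δ≈ ∘ Δ⊆))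

      module _ {φ : Fm n} (Cφ∈ : C φ ∈ cl) {bad : List Pair}
        (trapped : ∀ {v} → v ∈ bad → Trapped SomeAccessible (Refutes φ) alive bad v) where

        Confined : List (Fm n) → Set
        Confined Γ = ∀ {Γ′ Δ′} → (Γ′ , Δ′) ∈ alive → Γ ⊆ Γ′ → (Γ′ , Δ′) ∈ bad

        -- A living pair that extends the modal premise is accessible from a trapped pair, hence
        -- bad. So confinement survives each modal step.
        unboxed-confined : ∀ {Γ Γ′ Δ′ a} → (Γ′ , Δ′) ∈ bad → Γ ≈L Γ′ → Confined (unboxed s a Γ)
        unboxed-confined {a = a} v∈ (_ , Γ⊇) u∈ ⊆u =
          proj₂ (trapped v∈) u∈ (a , ⊆u ∘ unboxed-mono s Γ⊇)

        -- The companion of the cycle is Γ ⇒ Cφ in focus; rest lists the antecedents not yet used in one.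
        common : ∀ k rest {H} → length rest < k →
          (∀ {Γ} → Γ ∈ sublists cl → Γ ∈ rest ⊎ sequent [ C φ ^ foc ] Γ [] ∈ H) →
          ∀ {Γ} → Γ ⊆ cl → Confined Γ → Deriv s H (sequent [ C φ ^ foc ] Γ [])
        common (suc k) rest {H} len restOrH {Γ} Γ⊆ confined = by (restOrH (filter∈sublists (_∈? Γ) cl))
          where
          ρ : Seq n
          ρ = sequent [ C φ ^ foc ] (canonical Γ) []
          m : Mode H [ C φ ^ foc ]
          m = focused (isC φ)
          Γ≈ : Γ ≈L canonical Γ
          Γ≈ = canonical-≈ Γ⊆
          canonical⊆ : canonical Γ ⊆ cl
          canonical⊆ = Γ⊆ ∘ proj₂ Γ≈
          e : sequent [ C φ ^ foc ] Γ [] ≈S ρ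
          e = sequent-resp {Δ = []} Γ≈ ≈L-refl
          component : Provable (canonical Γ , [ φ ])
          component = provable {Δ = [ φ ]} canonical⊆ (λ { (here refl) → cl-closed Cφ∈ (here refl) })
            -- A living extension would be bad by confinement, and bad pairs do not refute `φ`.
            λ v∈ ⊆v φ∈ → proj₁ (trapped (confined v∈ (⊆v ∘ proj₁ Γ≈))) (φ∈ (here refl))
          by : canonical Γ ∈ rest ⊎ ρ ∈ H → Deriv s H (sequent [ C φ ^ foc ] Γ [])
          by (inj₂ ρ∈) = bud ρ∈ e (isSequent m Γ []) (hasFocus Γ [])
          by (inj₁ Γ∈rest) with remove Γ∈rest
          ... | rest′ , eq , split , _ =
            -- The antecedent moves from `rest` to the companions. The premise for `φ` has lost the
            -- focus, so it must be `closed`; the others keep it.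
            crFoc (cR (unfocus (canonical Γ)) [] φ foc) tt e (isSequent m Γ []) (hasFocus Γ [])
              (closed component ∷ All.map⁺ (All.universal boxed (allFin (suc n))))
            where
            restOrH′ : ∀ {Γ′} → Γ′ ∈ sublists cl → Γ′ ∈ rest′ ⊎ sequent [ C φ ^ foc ] Γ′ [] ∈ ρ ∷ H
            restOrH′ Γ′∈ with restOrH Γ′∈
            ... | inj₂ ∈H = inj₂ (there ∈H)
            ... | inj₁ ∈rest with split ∈rest
            ...   | inj₁ refl = inj₂ (here refl)
            ...   | inj₂ ∈rest′ = inj₁ ∈rest′

            module _ (a : Fin (suc n)) where
              F : List (AFm n)
              F = [ K a (C φ) ^ foc ]
              mode : Mode (ρ ∷ H) F
              mode = focused (isKC a φ)
              unfocusing : ∀ {Γ′ Δ′} → Deriv s (ρ ∷ H) (unfocus Γ′ ⊢ (K a (C φ) ^ unf ∷ unfocus Δ′ ++ [])) →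
                Deriv s (ρ ∷ H) (sequent F Γ′ Δ′)
              unfocusing {Δ′ = Δ′} d =
                infer mode (uRule _ (unfocus Δ′ ++ []) (K a (C φ))) (≈L-refl , ++-∷-≈L (unfocus Δ′)) (d ∷ [])
              leaf : ∀ {Γ′ Δ′} → canonical Γ ⊆ Γ′ → [ K a (C φ) ] ⊆ Δ′ → Γ′ ⊆ cl → Δ′ ⊆ cl →
                Saturated s Γ′ Δ′ → Deriv s (ρ ∷ H) (sequent F Γ′ Δ′)
              leaf {Γ′} {Δ′} ⊆Γ′ ⊆Δ′ Γ′⊆ Δ′⊆ sat with verdict Γ′⊆ Δ′⊆ sat
              ... | inj₁ d =
                -- A provable leaf is reached by dropping the focus: the principal formula merges
                -- with its unfocused copy in `Δ′`.
                unfocusing (closed (Deriv-resp s (principalR (unfocused {H = []} refl) (⊆Δ′ (here refl))) d))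
              ... | inj₂ (v , v∈ , Γ′≈ , _) =
                -- The leaf matches a living pair, which confinement makes bad. The modal rule
                -- carries the focus on to `C φ`, over a confined antecedent again.
                modalStep mode (++-∷-≈L (unfocus Δ′))
                  (common k rest′ (s≤s⁻¹ (subst (_< suc k) eq len)) restOrH′
                    (unboxed-closed s cl-closed Γ′⊆)
                    (unboxed-confined (confined v∈ (proj₁ Γ′≈ ∘ ⊆Γ′ ∘ proj₁ Γ≈)) Γ′≈))
              boxed : Deriv s (ρ ∷ H) (sequent F (canonical Γ) [])
              -- The conclusion K a (C φ) ^ foc is kept when it is unfocused: this weakening makes the
              -- saturated leaves contain K a (C φ) unfocused.
              boxed = infer {Δ = []} mode (uRule _ F (K a (C φ))) (≈L-refl , ∈⇒≈∷ (here refl))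
                (saturate s cl-closed (λ Γ Δ → Deriv s (ρ ∷ H) (sequent F Γ Δ))
                  (invertibleL mode) (invertibleR mode) (identity mode)
                  canonical⊆ (λ { (here refl) → cl-closed Cφ∈ (there (∈-map⁺ _ (∈-allFin a))) }) leaf
                 ∷ [])

      -- If the witness for an implication or a box is missing, `provable` applies to the premise of
      -- its right rule; for `C φ` the cyclic construction `common` takes over.
      demandOrProvable : ∀ {Γ Δ} → (Γ , Δ) ∈ alive → Saturated s Γ Δ →
        ∀ {χ} → χ ∈ Δ → Demand alive (Γ , Δ) χ ⊎ Provable (Γ , Δ)
      demandOrProvable _ _ {⊥'} _ = inj₁ tt
      demandOrProvable _ _ {atom _} _ = inj₁ tt
      demandOrProvable _ _ {_ ∧ _} _ = inj₁ tt
      demandOrProvable _ _ {_ ∨ _} _ = inj₁ tt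
      demandOrProvable {Γ} {Δ} w∈ _ {φ ⊃ ψ} χ∈
        with search (λ (Γ′ , Δ′) → (Γ ⊆? Γ′) ×-dec (φ ∈? Γ′) ×-dec (ψ ∈? Δ′)) alive
      ... | inj₂ witness = inj₁ witness
      ... | inj₁ none = inj₂ (infer m (impR _ _ φ ψ) (principalR m χ∈) (premise ∷ []))
        where
        m : Mode [] []
        m = unfocused refl
        parts : components (φ ⊃ ψ) ⊆ cl
        parts = cl-closed (proj₂ (alive⊆cl w∈) χ∈)
        premise : Provable (φ ∷ Γ , [ ψ ])
        premise = provable {Γ = φ ∷ Γ} {Δ = [ ψ ]}
          (⊆.∈-∷⁺ʳ (parts (here refl)) (proj₁ (alive⊆cl w∈))) (parts ∘ there)
          λ v∈ ⊆Γ′ ⊆Δ′ → none v∈ (⊆Γ′ ∘ there , ⊆Γ′ (here refl) , ⊆Δ′ (here refl))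
      demandOrProvable {Γ} {Δ} w∈ _ {K a φ} χ∈
        with search (λ (Γ′ , Δ′) → (unboxed s a Γ ⊆? Γ′) ×-dec (φ ∈? Δ′)) alive
      ... | inj₂ witness = inj₁ witness
      ... | inj₁ none = inj₂ (modalStep m (proj₂ (principalR m {Γ = Γ} χ∈)) premise)
        where
        m : Mode [] []
        m = unfocused refl
        premise : Provable (unboxed s a Γ , [ φ ])
        premise = provable {Δ = [ φ ]} (unboxed-closed s cl-closed (proj₁ (alive⊆cl w∈)))
          (λ { (here refl) → cl-closed (proj₂ (alive⊆cl w∈) χ∈) (here refl) })
          λ v∈ ⊆Γ′ ⊆Δ′ → none v∈ (⊆Γ′ , ⊆Δ′ (here refl))
      demandOrProvable {Γ} {Δ} w∈ (_ , metR , _) {C φ} χ∈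
        with reachability SomeAccessible (Refutes φ)
               (λ (Γ , _) (Γ′ , _) → Fin.any? λ a → unboxed s a Γ ⊆? Γ′) (λ (_ , Δ) → φ ∈? Δ) alive
      ... | bad , _ , reachOrBad , trapped with reachOrBad w∈
      ...   | inj₁ reach = inj₁ reach
      ...   | inj₂ w∈bad with metR χ∈
      -- Saturation has put `φ` or some `K a (C φ)` into `Δ`, and a bad pair excludes the former.
      ...     | here (_ , φ∈) = ⊥-elim (proj₁ (trapped w∈bad) (φ∈ (here refl)))
      ...     | there met with find (Any.map⁻ met)
      ...       | a , _ , (_ , Kφ∈) =
        -- The focus is placed on that `K a (C φ)`, and the modal rule leads to `C φ` in focus. No
        -- antecedent has served as a companion yet, so `common` starts with all sublists of `cl`.
        inj₂ (infer m (fRule _ _ (K a (C φ))) (principalR m (Kφ∈ (here refl))) (premise ∷ []))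
        where
        m : Mode [] []
        m = unfocused refl
        Cφ∈ : C φ ∈ cl
        Cφ∈ = proj₂ (alive⊆cl w∈) χ∈
        premise : Deriv s [] (unfocus Γ ⊢ (K a (C φ) ^ foc ∷ unfocus Δ ++ []))
        premise = Deriv-resp s (≈L-refl , ++-∷-≈L (unfocus Δ))
          (modalStep {Δ = Δ} (focused (isKC a φ)) (++-∷-≈L (unfocus Δ))
            (common Cφ∈ trapped _ (sublists cl) ℕ.≤-refl inj₁
              (unboxed-closed s cl-closed (proj₁ (alive⊆cl w∈)))
              (unboxed-confined Cφ∈ trapped w∈bad ≈L-refl)))

      goodOrSettled : ∀ {w} → w ∈ alive → Good alive w ⊎ Settled w
      goodOrSettled {Γ , Δ} w∈ with saturatedOrDefect s Γ Δ
      ... | inj₂ defect = inj₂ (⊥-elim ∘ ¬saturated s defect)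
      ... | inj₁ sat with allOrAny Δ (demandOrProvable w∈ sat)
      ...   | inj₁ demands = inj₁ (sat , demands)
      ...   | inj₂ (_ , _ , d) = inj₂ λ _ → d

    survivors : ∃ λ alive → alive ⊆ pairs × (∀ {w} → w ∈ pairs → Settled w ⊎ w ∈ alive) ×
      (∀ {w} → w ∈ alive → Good alive w)
    survivors = eliminate pairs λ _ alive⊆ settledOrAlive → goodOrSettled alive⊆ settledOrAlive

-- The model on the surviving pairs

  T-closed : ∀ {Γ Δ : List (Fm n)} {a φ} → HasT s → Saturated s Γ Δ → K a φ ∈ Γ → φ ∈ Γ
  T-closed hasT (metL , _) Kφ∈ with hasT? s | metL Kφ∈
  ... | yes _ | here (φ∈ , _) = φ∈ (here refl)
  ... | no ¬T | _ = ⊥-elim (¬T hasT)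

  Accessible-refl : ∀ {Γ Δ} → HasT s → Saturated s Γ Δ → ∀ a → Accessible a (Γ , Δ) (Γ , Δ)
  Accessible-refl {Γ} {Δ} hasT sat a φ∈ with modal s
  ... | inj₁ _ = T-closed {Δ = Δ} hasT sat (∈boxes⁻ Γ φ∈)
  ... | inj₂ _ with ∈-map⁻ (K a) φ∈
  ...   | _ , ψ∈ , refl = ∈boxes⁻ Γ ψ∈

  K-S4-disjoint : ∀ {s} → HasK s → ¬ HasS4 s
  K-S4-disjoint () s4ICKS4

  Accessible-trans : ∀ {u v w} → HasS4 s → ∀ a → Accessible a u v → Accessible a v w → Accessible a u w
  Accessible-trans {v = Γ , _} hasS4 a uv vw φ∈ with modal s
  ... | inj₁ hasK = ⊥-elim (K-S4-disjoint hasK hasS4)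
  ... | inj₂ _ with ∈-map⁻ (K a) φ∈
  ...   | _ , _ , refl = vw (∈-map⁺ (K a) (∈boxes⁺ Γ (uv φ∈)))

  -- In the S4 case the successor inherits `K a φ` itself, and its saturation under the T rule
  -- yields `φ`.
  Accessible-K : ∀ {Γ Δ Γ′ Δ′ a φ} → Saturated s Γ′ Δ′ → Accessible a (Γ , Δ) (Γ′ , Δ′) →
    K a φ ∈ Γ → φ ∈ Γ′
  Accessible-K {Γ} {Δ′ = Δ′} sat acc Kφ∈ with modal s
  ... | inj₁ _ = acc (∈boxes⁺ Γ Kφ∈)
  ... | inj₂ hasS4 = T-closed {Δ = Δ′} (S4⇒T hasS4) sat (acc (∈-map⁺ (K _) (∈boxes⁺ Γ Kφ∈)))

  module _ {alive : List Pair} (good : ∀ {w} → w ∈ alive → Good alive w) where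

    World : Set
    World = ℕ × Σ Pair (_∈ alive)

    forced refuted : World → List (Fm n)
    forced (_ , (Γ , _) , _) = Γ
    refuted (_ , (_ , Δ) , _) = Δ

    saturated : (w : World) → Saturated s (forced w) (refuted w)
    saturated (_ , _ , w∈) = proj₁ (good w∈)

    -- The counter makes the order antisymmetric although distinct pairs may share their antecedent.
    _⊏_ : World → World → Set
    v ⊏ w = proj₁ v < proj₁ w × forced v ⊆ forced w

    ⊏-trans : ∀ {u v w} → u ⊏ v → v ⊏ w → u ⊏ w
    ⊏-trans (i<j , u⊆v) (j<k , v⊆w) = ℕ.<-trans i<j j<k , v⊆w ∘ u⊆v

    survivorFrame : World → Frame n
    survivorFrame w₀ = record
      { W = World
      ; inhabited = w₀
      ; _≤_ = λ v w → v ≡ w ⊎ v ⊏ w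
      ; ≤-refl = inj₁ refl
      ; ≤-trans = λ
          { (inj₁ refl) q → q
          ; (inj₂ p) (inj₁ refl) → inj₂ p
          ; {u} {v} {w} (inj₂ p) (inj₂ q) → inj₂ (⊏-trans {u} {v} {w} p q) }
      ; ≤-antisym = λ
          { (inj₁ eq) _ → eq
          ; (inj₂ _) (inj₁ eq) → sym eq
          ; (inj₂ (i<j , _)) (inj₂ (j<i , _)) → ⊥-elim (ℕ.<-asym i<j j<i) }
      ; R = λ a (_ , v , _) (_ , w , _) → Accessible a v w
      ; triangle = λ
          { a (inj₁ refl) r → r
          ; a (inj₂ (_ , ⊆v)) r → r ∘ unboxed-mono s ⊆v }
      }

    module _ (w₀ : World) where

      F : Frame n
      F = survivorFrame w₀

      V : Valuation F
      V p w = atom p ∈ forced w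

      ≤⇒⊆ : ∀ {v w} → Frame._≤_ F v w → forced v ⊆ forced w
      ≤⇒⊆ (inj₁ refl) = id
      ≤⇒⊆ (inj₂ (_ , ⊆w)) = ⊆w

      -- Saturation unfolds `C φ` into `K a (C φ)` for every agent, so `C φ` crosses each edge of
      -- the path.
      C-forced : ∀ {φ v w} → Star (Rall F V) v w → C φ ∈ forced v → C φ ∈ forced w
      C-forced ε Cφ∈ = Cφ∈
      C-forced {v = v} (_◅_ {j = u} (a , acc) rest) Cφ∈ with proj₁ (saturated v) Cφ∈
      ... | here (new∈ , _) =
        C-forced rest (Accessible-K {Δ = refuted v} (saturated u) acc (new∈ (there (∈-map⁺ _ (∈-allFin a)))))

      -- That `φ` is refuted is taken as a hypothesis: the induction here is on the path, while the
      -- recursion of `refutes` stays structural in the formula.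
      C-refuted : ∀ {φ} → (∀ w → φ ∈ refuted w → ¬ sat F V w φ) →
        ∀ {i v} (v∈ : v ∈ alive) → Reach SomeAccessible (Refutes φ) alive v → ¬ sat F V (i , v , v∈) (C φ)
      C-refuted refutes v∈ (here φ∈) allφ = refutes _ φ∈ (allφ _ ε)
      C-refuted refutes v∈ (step u∈ r reach) allφ =
        -- Accessibility compares the pairs only, so the counter can be chosen freely.
        C-refuted refutes {i = 0} u∈ reach λ w path → allφ w (r ◅ path)

      -- The truth lemma, by simultaneous induction on the formula. Saturation settles what is
      -- forced, with persistence along the order for implications; `Demand` supplies the witnesses
      -- for refuted implications, boxes and `C`.
      forces : ∀ φ w → φ ∈ forced w → sat F V w φ
      refutes : ∀ φ w → φ ∈ refuted w → ¬ sat F V w φ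

      forces ⊥' w φ∈ with proj₁ (saturated w) φ∈
      ... | ()
      forces (atom p) w φ∈ = φ∈
      forces (φ ∧ ψ) w φ∈ with proj₁ (saturated w) φ∈
      ... | here (new∈ , _) = forces φ w (new∈ (here refl)) , forces ψ w (new∈ (there (here refl)))
      forces (φ ∨ ψ) w φ∈ with proj₁ (saturated w) φ∈
      ... | here (new∈ , _) = inj₁ (forces φ w (new∈ (here refl)))
      ... | there (here (new∈ , _)) = inj₂ (forces ψ w (new∈ (here refl)))
      forces (φ ⊃ ψ) w φ∈ v w≤v satφ with proj₁ (saturated v) (≤⇒⊆ {w} {v} w≤v φ∈)
      ... | here (_ , new∈) = ⊥-elim (refutes φ v (new∈ (here refl)) satφ)
      ... | there (here (new∈ , _)) = forces ψ v (new∈ (here refl))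
      forces (K a φ) w φ∈ v acc = forces φ v (Accessible-K {Δ = refuted w} (saturated v) acc φ∈)
      forces (C φ) w φ∈ v path with proj₁ (saturated v) (C-forced path φ∈)
      ... | here (new∈ , _) = forces φ v (new∈ (here refl))

      refutes ⊥' w _ ()
      refutes (atom p) w φ∈ p∈ = proj₂ (proj₂ (saturated w)) p∈ φ∈
      refutes (φ ∧ ψ) w φ∈ (satφ , satψ) with proj₁ (proj₂ (saturated w)) φ∈
      ... | here (_ , new∈) = refutes φ w (new∈ (here refl)) satφ
      ... | there (here (_ , new∈)) = refutes ψ w (new∈ (here refl)) satψ
      refutes (φ ∨ ψ) w φ∈ satφ∨ψ with proj₁ (proj₂ (saturated w)) φ∈ | satφ∨ψ
      ... | here (_ , new∈) | inj₁ satφ = refutes φ w (new∈ (here refl)) satφ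
      ... | here (_ , new∈) | inj₂ satψ = refutes ψ w (new∈ (there (here refl))) satψ
      refutes (φ ⊃ ψ) (i , w , w∈) φ∈ satφ⊃ψ with proj₂ (good w∈) φ∈
      ... | v , v∈ , w⊆v , φ∈v , ψ∈v =
        refutes ψ v′ ψ∈v (satφ⊃ψ v′ (inj₂ (ℕ.n<1+n i , w⊆v)) (forces φ v′ φ∈v))
        where
        v′ : World
        -- The raised counter puts the witness strictly above the given world.
        v′ = suc i , v , v∈
      refutes (K a φ) (_ , w , w∈) φ∈ satKφ with proj₂ (good w∈) φ∈
      ... | v , v∈ , acc , φ∈v = refutes φ (0 , v , v∈) φ∈v (satKφ _ acc)
      refutes (C φ) (i , w , w∈) φ∈ = C-refuted (refutes φ) w∈ (proj₂ (good w∈) φ∈)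

      forces-⋀ : ∀ w Γ → map fm Γ ⊆ forced w → sat F V w (⋀ Γ)
      forces-⋀ w [] _ = λ _ _ ()
      forces-⋀ w (χ ∷ Γ) Γ⊆ = forces (fm χ) w (Γ⊆ (here refl)) , forces-⋀ w Γ (Γ⊆ ∘ there)

      refutes-⋁ : ∀ w Δ → map fm Δ ⊆ refuted w → ¬ sat F V w (⋁ Δ)
      refutes-⋁ w (χ ∷ Δ) Δ⊆ (inj₁ satχ) = refutes (fm χ) w (Δ⊆ (here refl)) satχ
      refutes-⋁ w (χ ∷ Δ) Δ⊆ (inj₂ satΔ) = refutes-⋁ w Δ (Δ⊆ ∘ there) satΔ

      V-monotone : Monotone F V
      V-monotone p {v} {w} v≤w = ≤⇒⊆ {v} {w} v≤w

      invalid : ∀ {cls σ} → InClass cls F → map fm (ante σ) ⊆ forced w₀ → map fm (succ σ) ⊆ refuted w₀ →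
        ¬ ValidSeq cls σ
      invalid {σ = Γ ⊢ Δ} inClass Γ⊆ Δ⊆ valid =
        refutes-⋁ w₀ Δ Δ⊆ (valid F inClass V V-monotone w₀ w₀ (inj₁ refl) (forces-⋀ w₀ Γ Γ⊆))

frameClass : Sys → FrameClass
frameClass ICK = epistemic
frameClass ICKT = reflexive
frameClass ICKS4 = s4

survivorFrame-inClass : ∀ {n} s {alive} (good : ∀ {w} → w ∈ alive → Good {n} s alive w) w₀ →
  InClass (frameClass s) (survivorFrame s good w₀)
survivorFrame-inClass ICK good w₀ = tt
survivorFrame-inClass ICKT good w₀ a (_ , _ , w∈) = Accessible-refl ICKT tICKT (proj₁ (good w∈)) a
survivorFrame-inClass ICKS4 good w₀ =
  (λ a (_ , _ , w∈) → Accessible-refl ICKS4 tICKS4 (proj₁ (good w∈)) a) ,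
  λ a {u} {v} {w} → Accessible-trans ICKS4 {proj₁ (proj₂ u)} {proj₁ (proj₂ v)} {proj₁ (proj₂ w)} s4ICKS4 a

-- Completeness

module _ {n : ℕ} (s : Sys) where

  -- A surviving pair extending `σ` would be a world refuting it, in a frame of the right class. So
  -- there is none, and `provable` applies.
  completeUnfocused : (σ : Seq n) → ValidSeq (frameClass s) σ → Provable s (map fm (ante σ) , map fm (succ σ))
  completeUnfocused σ valid with survivors s (closures-closed (map fm (ante σ) ++ map fm (succ σ)))
  ... | alive , alive⊆ , settledOrAlive , good =
    provable s (closures-closed (Γ ++ Δ)) alive⊆ settledOrAlive
      (⊆closures (Γ ++ Δ) ∘ ∈-++⁺ˡ) (⊆closures (Γ ++ Δ) ∘ ∈-++⁺ʳ Γ)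
      λ v∈ Γ⊆ Δ⊆ → let w₀ = 0 , _ , v∈ in
        invalid s good w₀ {σ = σ} (survivorFrame-inClass s good w₀) Γ⊆ Δ⊆ valid
    where
    Γ Δ : List (Fm n)
    Γ = map fm (ante σ)
    Δ = map fm (succ σ)

  isFoc? : (χ : AFm n) → Dec (ann χ ≡ foc)
  isFoc? (_ ^ unf) = no λ ()
  isFoc? (_ ^ foc) = yes refl

  ≢foc⇒≡unf : ∀ {x : Ann} → x ≢ foc → x ≡ unf
  ≢foc⇒≡unf {unf} _ = refl
  ≢foc⇒≡unf {foc} x≢foc = ⊥-elim (x≢foc refl)

  unfocus-fm : ∀ {Γ : List (AFm n)} → (∀ {χ} → χ ∈ Γ → ann χ ≡ unf) → unfocus s (map fm Γ) ≡ Γ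
  unfocus-fm {[]} _ = refl
  unfocus-fm {(φ ^ x) ∷ Γ} allUnf with allUnf (here refl)
  ... | refl = cong (_ ∷_) (unfocus-fm (allUnf ∘ there))

  complete : (σ : Seq n) → IsSequent σ → ValidSeq (frameClass s) σ → Deriv s [] σ
  complete σ@(Γ ⊢ Δ) is valid with search isFoc? Δ
  ... | inj₁ noFocus =
    subst (Deriv s []) (cong₂ _⊢_ (unfocus-fm (IsSequent.anteUnf is))
      (trans (++-identityʳ _) (unfocus-fm (≢foc⇒≡unf ∘ noFocus)))) (completeUnfocused σ valid)
  ... | inj₂ ((φ ^ foc) , φ∈ , refl) =
    -- `completeUnfocused` proves `σ` with all annotations erased; one instance of `uRule` restores
    -- the focus on `φ`.
    step (uRule Γ Δ⁻ φ) (≈L-refl , conclusion≈) is (inj₁ refl)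
      (Deriv-resp s (Γ≈ , premise≈) (completeUnfocused σ valid) ∷ [])
    where
    Δ⁻ : List (AFm n)
    Δ⁻ = filter (λ χ → ¬? (isFoc? χ)) Δ
    Γ≈ : unfocus s (map fm Γ) ≈L Γ
    Γ≈ = subst (_≈L Γ) (sym (unfocus-fm (IsSequent.anteUnf is))) ≈L-refl
    unfocused∈ : ∀ {χ} → χ ∈ Δ → (fm χ ^ unf) ∈ unfocus s (map fm Δ) ++ []
    unfocused∈ χ∈ = ∈-++⁺ˡ (∈-map⁺ (_^ unf) (∈-map⁺ fm χ∈))
    conclusion≈ : Δ ≈L (φ ^ foc ∷ Δ⁻)
    conclusion≈ = to , ⊆.∈-∷⁺ʳ φ∈ (proj₁ ∘ ∈-filter⁻ (λ χ → ¬? (isFoc? χ)) {xs = Δ})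
      where
      to : Δ ⊆ φ ^ foc ∷ Δ⁻
      to {χ} χ∈ with isFoc? χ
      ... | yes χfoc = here (IsSequent.focOne is χ∈ φ∈ χfoc refl)
      ... | no ¬foc = there (∈-filter⁺ (λ χ → ¬? (isFoc? χ)) χ∈ ¬foc)
    premise≈ : (unfocus s (map fm Δ) ++ []) ≈L (φ ^ unf ∷ Δ⁻)
    premise≈ = to , ⊆.∈-∷⁺ʳ (unfocused∈ φ∈) from
      where
      to : unfocus s (map fm Δ) ++ [] ⊆ φ ^ unf ∷ Δ⁻
      to χ∈ with ∈-map⁻ (_^ unf) (subst (_ ∈_) (++-identityʳ _) χ∈)
      ... | _ , ψ∈ , refl with ∈-map⁻ fm ψ∈
      ...   | (ψ ^ unf) , χ′∈ , refl = there (∈-filter⁺ (λ χ → ¬? (isFoc? χ)) χ′∈ λ ())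
      ...   | (ψ ^ foc) , χ′∈ , refl with IsSequent.focOne is χ′∈ φ∈ refl refl
      ...     | refl = here refl
      from : Δ⁻ ⊆ unfocus s (map fm Δ) ++ []
      from {ψ ^ x} χ∈ with ∈-filter⁻ (λ χ → ¬? (isFoc? χ)) {xs = Δ} χ∈
      ... | χ∈Δ , ¬foc with ≢foc⇒≡unf ¬foc
      ...   | refl = unfocused∈ χ∈Δ

mainTheorem15 : (n : ℕ) (σ : Seq n) → IsSequent σ →
    (ValidSeq epistemic σ → CyclicProof ICK σ) ×
    (ValidSeq reflexive σ → CyclicProof ICKT σ) ×
    (ValidSeq s4 σ → CyclicProof ICKS4 σ)
mainTheorem15 n σ is =
  Deriv⇒CyclicProof ICK ∘ complete ICK σ is ,
  Deriv⇒CyclicProof ICKT ∘ complete ICKT σ is ,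
  Deriv⇒CyclicProof ICKS4 ∘ complete ICKS4 σ is
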